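{- Let $p>3$ be a prime. Then the following polynomial congruences hold in $\mathbb{Z}_{(p)}[t]$: \begin{align*} \sum_{k=0}^{p-1} \binom{2k}{k} t^{p-1-k} &\equiv 2u_p(t,t)-u_p(2-t) -2p^2\sum_{k=1}^{p-1}\frac{u_k(2-t)+u_k(t,t)}{k^2} \pmod{p^3}, \\ \sum_{k=1}^{p-1} \frac{\binom{2k}{k}}{k}\,t^{p-k} &\equiv \frac{3t^p+2-v_p(2-t)-4v_p(t,t)}{p} \pmod{p^2}, \\ \frac{1}{2}\sum_{k=1}^{p-1} \frac{\binom{2k}{k}}{k^2}\,t^{p-k} &\equiv \frac{v_p(2-t)+2v_p(t,t)-t^p-2}{p^2}+\sum_{k=1}^{p-1} \frac{v_{k}(2-t)}{k^2} \pmod{p}. \end{align*}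
   Context: The two-variable Lucas polynomials are defined by $u_0(x,y)=0$, $u_1(x,y)=1$, $u_n(x,y)=x\,u_{n-1}(x,y)-y\,u_{n-2}(x,y)$ for $n>1$, and $v_0(x,y)=2$, $v_1(x,y)=x$, $v_n(x,y)=x\,v_{n-1}(x,y)-y\,v_{n-2}(x,y)$ for $n>1$; one writes $u_n(x)=u_n(x,1)$ and $v_n(x)=v_n(x,1)$. $\mathbb{Z}_{(p)}$ denotes the rationals whose denominators are prime to $p$; for polynomials $A,B\in\mathbb{Q}[t]$, $A\equiv B\pmod{p^m}$ means that $A-B\in p^m\mathbb{Z}_{(p)}[t]$. -}

module Defs where

open import Data.Nat as ℕ using (ℕ; zero; suc)
open import Data.Nat.Divisibility using (_∣_)
open import Data.Integer as ℤ using (ℤ; +_)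
open import Data.Rational as ℚ using (ℚ; ↧ₙ_)
open import Data.Product using (Σ; _×_)
open import Relation.Nullary using (¬_)
open import Relation.Binary.PropositionalEquality using (_≡_)

ℕ→ℚ : ℕ → ℚ
ℕ→ℚ n = (+ n) ℚ./ 1

-- 1/n for n ≥ 1 (convention: invℕ 0 = 0; only used at n ≥ 1).
invℕ : ℕ → ℚ
invℕ zero    = ℚ.0ℚ
invℕ (suc n) = (+ 1) ℚ./ suc n

-- Polynomials in t over ℚ, as coefficient sequences (coefficient of t^i).
Poly : Set
Poly = ℕ → ℚ

constP : ℚ → Poly
constP c zero    = c
constP c (suc i) = ℚ.0ℚ

tPow : ℕ → Poly
tPow k i with k ℕ.≟ i
... | Relation.Nullary.yes _ = ℚ.1ℚ
... | Relation.Nullary.no  _ = ℚ.0ℚ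

T : Poly
T = tPow 1

infixl 6 _+ₚ_ _-ₚ_
infixl 7 _*ₚ_ _·ₚ_

_+ₚ_ : Poly → Poly → Poly
(f +ₚ g) i = f i ℚ.+ g i

_-ₚ_ : Poly → Poly → Poly
(f -ₚ g) i = f i ℚ.- g i

_·ₚ_ : ℚ → Poly → Poly
(c ·ₚ f) i = c ℚ.* f i

sumℚ : (ℕ → ℚ) → ℕ → ℚ
sumℚ a zero    = a zero
sumℚ a (suc n) = sumℚ a n ℚ.+ a (suc n)

_*ₚ_ : Poly → Poly → Poly
(f *ₚ g) i = sumℚ (λ j → f j ℚ.* g (i ℕ.∸ j)) i

-- Σ_{k=a}^{b} F k  for polynomials (zero if b < a)
sumP : ℕ → ℕ → (ℕ → Poly) → Poly
sumP a b F i = go (suc b ℕ.∸ a)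
  where
  go : ℕ → ℚ
  go zero    = ℚ.0ℚ
  go (suc m) = go m ℚ.+ F (a ℕ.+ m) i

uL : Poly → Poly → ℕ → Poly
uL x y zero          = constP ℚ.0ℚ
uL x y (suc zero)    = constP ℚ.1ℚ
uL x y (suc (suc n)) = x *ₚ uL x y (suc n) -ₚ y *ₚ uL x y n

vL : Poly → Poly → ℕ → Poly
vL x y zero          = constP (ℕ→ℚ 2)
vL x y (suc zero)    = x
vL x y (suc (suc n)) = x *ₚ vL x y (suc n) -ₚ y *ₚ vL x y n

u₁ : Poly → ℕ → Poly
u₁ x = uL x (constP ℚ.1ℚ)

v₁ : Poly → ℕ → Poly
v₁ x = vL x (constP ℚ.1ℚ)

twoMinusT : Poly
twoMinusT = constP (ℕ→ℚ 2) -ₚ T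

-- ℤ_(p): rationals whose (reduced) denominator is prime to p.
-- (For p prime, "prime to p" is "not divisible by p".)
InZp : ℕ → ℚ → Set
InZp p r = ¬ (p ∣ (↧ₙ r))

InPmZp : ℕ → ℕ → ℚ → Set
InPmZp p m c = Σ ℚ (λ r → InZp p r × (c ≡ ℕ→ℚ (p ℕ.^ m) ℚ.* r))

CongP : ℕ → ℕ → Poly → Poly → Set
CongP p m A B = ∀ i → InPmZp p m (A i ℚ.- B i)

{-# OPTIONS --safe #-}
module Submission where

-- Let B(a, k) be the binomial coefficient with rational upper argument. The
-- coefficients of u_n(2−t), u_n(t,t), v_n(2−t), v_n(t,t) are, up to sign,
-- values of B; for n = p they are B(a − 2p, k) and B(a − p, k) with a = 2k
-- (respectively differences of such with a = 2k − 1), and for n = p − m they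
-- are congruent mod p to (−1)^m B(a, k − m) and B(a − m, k − m).
-- So the first two congruences say that the second difference
-- B(a, k) − 2B(a − p, k) + B(a − 2p, k) is known mod p³, and the third needs
-- B(a − 2p, k) − B(a − p, k) mod p². Both sides of these congruences obey
-- Pascal's rule in (a, k), which reduces them to a = 0. There
-- B(−x, k) = (−1)^k (x + x² H_{k−1} + O(x³))/k, and what remains is the
-- identity Σ_{m=1}^k (−1)^{m−1} C(k, m)/m = H_k for harmonic numbers.
-- The constant term of the third congruence is Σ 1/n² ≡ 0 (mod p).

open import Defs
import Data.Integer as ℤ
import Data.Integer.Properties as ℤ
open import Data.Nat as ℕ using (ℕ; zero; suc; z≤n; s≤s)
open import Data.Nat.Combinatorics using (_C_; nCn≡1; nCk≡nC[n∸k]; k>n⇒nCk≡0; nCk+nC[k+1]≡[n+1]C[k+1])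
open import Data.Nat.Divisibility using (_∣_; _∤_; divides; ∣⇒≤; ∣1⇒≡1; ∣-trans)
open import Data.Nat.Primality using (Prime; euclidsLemma; prime⇒irreducible)
import Data.Nat.Properties as ℕ
open import Data.Product using (_×_; _,_; proj₁)
open import Data.Rational using (ℚ; 0ℚ; 1ℚ; _+_; _*_; _-_; -_; toℚᵘ; ↧_; ↧ₙ_)
open import Data.Rational.Properties
import Data.Rational.Unnormalised as ℚᵘ
import Data.Rational.Unnormalised.Properties as ℚᵘ
open import Data.Sum using (_⊎_; inj₁; inj₂; [_,_])
open import Function using (_∘_)
open import Level using (0ℓ)
open import Relation.Binary.Definitions using (tri<; tri≈; tri>)
open import Relation.Binary.PropositionalEquality hiding ([_])
open import Relation.Nullary using (Dec; yes; no; contradiction)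
open import Relation.Nullary.Decidable using (dec⇒maybe)
open import Tactic.RingSolver using (solve-∀)
open import Tactic.RingSolver.Core.AlmostCommutativeRing using (AlmostCommutativeRing; fromCommutativeRing)

-- Since `B a k` is the coefficient of z^k in (1+z)^a, the correction terms come from power series.
-- For k < p the second difference is, mod p³, the coefficient of p² (1+z)^a log²(1+z), and B(a -
-- 2p, k) - B(a - p, k) is, mod p², that of -p (1+z)^a log(1+z). After n = p - m, the sums of
-- u_n(2-t)/n² and u_n(t,t)/n² become, mod p, (1+z)^a Li₂(-z) and (1+z)^a Li₂(z/(1+z)), and Landen's
-- identity makes them cancel log². The obstacle is the denominators. Those of the logarithm are
-- prime to p only below degree p, so the bound k ≤ p - 1 is carried everywhere. The divisions by p
-- and p² in the last two congruences are affordable because the coefficients of v_p in degrees 1 to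
-- p - 1 carry an explicit factor p: the second congruence then loses no power of p and the third
-- loses one.

ring : AlmostCommutativeRing 0ℓ 0ℓ
ring = fromCommutativeRing +-*-commutativeRing (λ x → dec⇒maybe (0ℚ ≟ x))

two three four : ℚ
two   = 1ℚ + 1ℚ
three = two + 1ℚ
four  = two + two

infixl 4 _⊞_
infix 5 _⊡_

_⊡_ : ∀ c {x y} → x ≡ y → c * (x - y) ≡ 0ℚ
_⊡_ c {x} refl = lem c x
  where
  lem : ∀ c x → c * (x - x) ≡ 0ℚ
  lem = solve-∀ ring

_⊞_ : ∀ {x y} → x ≡ 0ℚ → y ≡ 0ℚ → x + y ≡ 0ℚ
refl ⊞ refl = refl

-- An identity L ≡ R holding modulo equations xᵢ ≡ yᵢ is entered through
-- cofactors cᵢ, as by-cofactors (c₁ ⊡ e₁ ⊞ c₂ ⊡ e₂ ⊞ …); what remains to be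
-- checked is the ring identity L − R ≡ Σ cᵢ (xᵢ − yᵢ).
by-cofactors : ∀ {z l r} → z ≡ 0ℚ → l - r ≡ z → l ≡ r
by-cofactors {l = l} {r} refl e = trans (lem l r) (trans (cong (_+ r) e) (+-identityˡ r))
  where
  lem : ∀ l r → l ≡ (l - r) + r
  lem = solve-∀ ring

by-cofactor : ∀ c {x y l r} → x ≡ y → l - r ≡ c * (x - y) → l ≡ r
by-cofactor c h = by-cofactors (c ⊡ h)

-- Natural numbers in ℚ, their inverses, and signs

-- A recursive copy of `ℕ→ℚ`: here the successor rule holds by computation, so casts enter ring
-- identities directly.
cast : ℕ → ℚ
cast zero    = 0ℚ
cast (suc n) = cast n + 1ℚ

ℕ→ℚ-suc : ∀ n → ℕ→ℚ (suc n) ≡ ℕ→ℚ n + 1ℚ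
ℕ→ℚ-suc n = toℚᵘ-injective (begin
  toℚᵘ (ℕ→ℚ (suc n))                       ≈⟨ toℚᵘ-fromℚᵘ (ℚᵘ.mkℚᵘ (ℤ.+ suc n) 0) ⟩
  ℚᵘ.mkℚᵘ (ℤ.+ suc n) 0                     ≈⟨ ℚᵘ.*≡* (cong (ℤ._* ℤ.1ℤ) (trans (cong ℤ.+_ (ℕ.+-comm 1 n)) (cong (ℤ._+ ℤ.1ℤ) (sym (ℤ.*-identityʳ (ℤ.+ n)))))) ⟩
  ℚᵘ.mkℚᵘ (ℤ.+ n ℤ.* ℤ.1ℤ ℤ.+ ℤ.1ℤ) 0      ≈⟨ ℚᵘ.+-congˡ _ (toℚᵘ-fromℚᵘ (ℚᵘ.mkℚᵘ (ℤ.+ n) 0)) ⟨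
  toℚᵘ (ℕ→ℚ n) ℚᵘ.+ toℚᵘ 1ℚ                ≈⟨ toℚᵘ-homo-+ (ℕ→ℚ n) 1ℚ ⟨
  toℚᵘ (ℕ→ℚ n + 1ℚ)                        ∎)
  where open ℚᵘ.≃-Reasoning

ℕ→ℚ≡cast : ∀ n → ℕ→ℚ n ≡ cast n
ℕ→ℚ≡cast zero    = refl
ℕ→ℚ≡cast (suc n) = trans (ℕ→ℚ-suc n) (cong (_+ 1ℚ) (ℕ→ℚ≡cast n))

cast-+ : ∀ m n → cast (m ℕ.+ n) ≡ cast m + cast n
cast-+ zero    n = sym (+-identityˡ _)
cast-+ (suc m) n = trans (cong (_+ 1ℚ) (cast-+ m n)) (lem (cast m) (cast n))
  where
  lem : ∀ x y → (x + y) + 1ℚ ≡ (x + 1ℚ) + y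
  lem = solve-∀ ring

cast-* : ∀ m n → cast (m ℕ.* n) ≡ cast m * cast n
cast-* zero    n = sym (*-zeroˡ (cast n))
cast-* (suc m) n = trans (cast-+ n (m ℕ.* n)) (trans (cong (cast n +_) (cast-* m n)) (lem (cast m) (cast n)))
  where
  lem : ∀ x y → y + x * y ≡ (x + 1ℚ) * y
  lem = solve-∀ ring

cast-double : ∀ k → cast (2 ℕ.* k) ≡ two * cast k
cast-double k = cast-* 2 k

inv-* : ∀ n → invℕ (suc n) * cast (suc n) ≡ 1ℚ
inv-* n = trans (cong (invℕ (suc n) *_) (sym (ℕ→ℚ≡cast (suc n)))) (toℚᵘ-injective (begin
  toℚᵘ (invℕ (suc n) * ℕ→ℚ (suc n))                ≈⟨ toℚᵘ-homo-* (invℕ (suc n)) (ℕ→ℚ (suc n)) ⟩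
  toℚᵘ (invℕ (suc n)) ℚᵘ.* toℚᵘ (ℕ→ℚ (suc n))      ≈⟨ ℚᵘ.*-cong (toℚᵘ-fromℚᵘ (ℚᵘ.mkℚᵘ ℤ.1ℤ n)) (toℚᵘ-fromℚᵘ (ℚᵘ.mkℚᵘ (ℤ.+ suc n) 0)) ⟩
  ℚᵘ.mkℚᵘ ℤ.1ℤ n ℚᵘ.* ℚᵘ.mkℚᵘ (ℤ.+ suc n) 0         ≈⟨ ℚᵘ.*≡* (cong (ℤ.+_) (lem n)) ⟩
  ℚᵘ.1ℚᵘ                                           ∎))
  where
  open ℚᵘ.≃-Reasoning
  lem : ∀ n → (1 ℕ.* suc n) ℕ.* 1 ≡ 1 ℕ.* (suc n ℕ.* 1)
  lem n = ℕ.*-assoc 1 (suc n) 1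

inverse-unique : ∀ {x y c} → x * c ≡ 1ℚ → y * c ≡ 1ℚ → x ≡ y
inverse-unique {x} {y} {c} h k =
  trans (sym (*-identityʳ x)) (trans (cong (x *_) (sym k)) (trans (lem x y c) (trans (cong (y *_) h) (*-identityʳ y))))
  where
  lem : ∀ x y c → x * (y * c) ≡ y * (x * c)
  lem = solve-∀ ring

inv-homo-* : ∀ m n → invℕ (suc m ℕ.* suc n) ≡ invℕ (suc m) * invℕ (suc n)
inv-homo-* m n = inverse-unique (inv-* (n ℕ.+ m ℕ.* suc n))
  (trans (cong (invℕ (suc m) * invℕ (suc n) *_) (cast-* (suc m) (suc n)))
  (trans (lem (invℕ (suc m)) (invℕ (suc n)) (cast (suc m)) (cast (suc n)))
  (cong₂ _*_ (inv-* m) (inv-* n))))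
  where
  lem : ∀ x y c d → x * y * (c * d) ≡ (x * c) * (y * d)
  lem = solve-∀ ring

sgn : ℕ → ℚ
sgn zero    = 1ℚ
sgn (suc n) = - sgn n

sgn-+ : ∀ m n → sgn (m ℕ.+ n) ≡ sgn m * sgn n
sgn-+ zero    n = sym (*-identityˡ _)
sgn-+ (suc m) n = trans (cong -_ (sgn-+ m n)) (neg-distribˡ-* (sgn m) (sgn n))

sgn² : ∀ n → sgn n * sgn n ≡ 1ℚ
sgn² zero    = refl
sgn² (suc n) = trans (lem (sgn n)) (sgn² n)
  where
  lem : ∀ x → (- x) * (- x) ≡ x * x
  lem = solve-∀ ring

-- Finite sums

S : ℕ → (ℕ → ℚ) → ℚ
S zero    f = 0ℚ
S (suc n) f = S n f + f n

S-cong : ∀ N {f g} → (∀ m → m ℕ.< N → f m ≡ g m) → S N f ≡ S N g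
S-cong zero    h = refl
S-cong (suc N) h = cong₂ _+_ (S-cong N (λ m m<N → h m (ℕ.m<n⇒m<1+n m<N))) (h N ℕ.≤-refl)

S-+ : ∀ N f g → S N (λ m → f m + g m) ≡ S N f + S N g
S-+ zero    f g = refl
S-+ (suc N) f g = trans (cong (_+ (f N + g N)) (S-+ N f g)) (lem (S N f) (S N g) (f N) (g N))
  where
  lem : ∀ x y z w → (x + y) + (z + w) ≡ (x + z) + (y + w)
  lem = solve-∀ ring

S-* : ∀ N c f → S N (λ m → c * f m) ≡ c * S N f
S-* zero    c f = sym (*-zeroʳ c)
S-* (suc N) c f = trans (cong (_+ c * f N) (S-* N c f)) (sym (*-distribˡ-+ c (S N f) (f N)))

S-0 : ∀ N {f} → (∀ m → m ℕ.< N → f m ≡ 0ℚ) → S N f ≡ 0ℚ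
S-0 zero    h = refl
S-0 (suc N) h = cong₂ _+_ (S-0 N (λ m m<N → h m (ℕ.m<n⇒m<1+n m<N))) (h N ℕ.≤-refl)

S-tail : ∀ {k N} f → k ℕ.≤ N → (∀ m → k ℕ.≤ m → f m ≡ 0ℚ) → S N f ≡ S k f
S-tail {k} {N} f k≤N h with ℕ.m≤n⇒m<n∨m≡n k≤N
... | inj₂ refl = refl
S-tail {k} {suc N} f k≤N h | inj₁ (s≤s k≤N') =
  trans (cong₂ _+_ (S-tail f k≤N' h) (h N k≤N')) (+-identityʳ _)

S-single : ∀ {N j} f → j ℕ.< N → (∀ m → m ℕ.< N → m ≢ j → f m ≡ 0ℚ) → S N f ≡ f j
S-single {suc N} {j} f j<N h with N ℕ.≟ j
... | yes refl = trans (cong (_+ f N) (S-0 N (λ m m<N → h m (ℕ.m<n⇒m<1+n m<N) (ℕ.<⇒≢ m<N)))) (+-identityˡ _)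
... | no N≢j   = trans (cong₂ _+_ (S-single f (ℕ.≤∧≢⇒< (ℕ.s≤s⁻¹ j<N) (N≢j ∘ sym)) (λ m m<N → h m (ℕ.m<n⇒m<1+n m<N))) (h N ℕ.≤-refl N≢j)) (+-identityʳ _)

S-first : ∀ N f → S (suc N) f ≡ f 0 + S N (f ∘ suc)
S-first zero    f = +-comm 0ℚ (f 0)
S-first (suc N) f = trans (cong (_+ f (suc N)) (S-first N f)) (+-assoc (f 0) _ _)

S-reverse : ∀ N f → S N f ≡ S N (λ m → f (N ℕ.∸ suc m))
S-reverse zero    f = refl
S-reverse (suc N) f = trans (cong (_+ f N) (S-reverse N f))
  (trans (+-comm _ (f N)) (sym (S-first N (λ m → f (suc N ℕ.∸ suc m)))))

-- Binomial coefficients with rational upper argument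

harmonic : ℕ → ℚ
harmonic n = S n (λ m → invℕ (suc m))

B : ℚ → ℕ → ℚ
B a zero    = 1ℚ
B a (suc k) = B a k * (a - cast k) * invℕ (suc k)

-- Cross-multiplied because `a + 1ℚ - cast k` may vanish. Absorption, and through it Pascal's rule,
-- follow from this form.
B-upper : ∀ a k → (a + 1ℚ - cast k) * B (a + 1ℚ) k ≡ (a + 1ℚ) * B a k
B-upper a zero    = cong (_* 1ℚ) (+-identityʳ (a + 1ℚ))
B-upper a (suc k) = by-cofactor ((a - cast k) * invℕ (suc k)) (B-upper a k)
  (lem a (cast k) (B (a + 1ℚ) k) (B a k) (invℕ (suc k)))
  where
  lem : ∀ a k x y i → (a + 1ℚ - (k + 1ℚ)) * (x * (a + 1ℚ - k) * i) - (a + 1ℚ) * (y * (a - k) * i)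
      ≡ (a - k) * i * ((a + 1ℚ - k) * x - (a + 1ℚ) * y)
  lem = solve-∀ ring

B-absorb : ∀ a k → B (a + 1ℚ) (suc k) ≡ (a + 1ℚ) * B a k * invℕ (suc k)
B-absorb a k = trans (cong (_* invℕ (suc k)) (*-comm (B (a + 1ℚ) k) _)) (cong (_* invℕ (suc k)) (B-upper a k))

B-pascal : ∀ a k → B (a + 1ℚ) (suc k) ≡ B a (suc k) + B a k
B-pascal a k = trans (B-absorb a k) (by-cofactor (B a k) (inv-* k) (lem a (cast k) (B a k) (invℕ (suc k))))
  where
  lem : ∀ a k x i → (a + 1ℚ) * x * i - (x * (a - k) * i + x) ≡ x * (i * (k + 1ℚ) - 1ℚ)
  lem = solve-∀ ring

B-zero : ∀ n → B (cast n) (suc n) ≡ 0ℚ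
B-zero n = lem (B (cast n) n) (cast n) (invℕ (suc n))
  where
  lem : ∀ x a i → x * (a - a) * i ≡ 0ℚ
  lem = solve-∀ ring

B0-suc : ∀ k → B 0ℚ (suc k) ≡ 0ℚ
B0-suc zero    = refl
B0-suc (suc k) = trans (cong (λ x → x * (0ℚ - cast (suc k)) * invℕ (suc (suc k))) (B0-suc k)) (lem (0ℚ - cast (suc k)) (invℕ (suc (suc k))))
  where
  lem : ∀ x i → 0ℚ * x * i ≡ 0ℚ
  lem = solve-∀ ring

B-diag : ∀ n → B (cast n) n ≡ 1ℚ
B-diag zero    = refl
B-diag (suc n) = trans (B-absorb (cast n) n) (trans (cong (λ x → (cast n + 1ℚ) * x * invℕ (suc n)) (B-diag n))
  (trans (lem (cast n + 1ℚ) (invℕ (suc n))) (inv-* n)))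
  where
  lem : ∀ x i → x * 1ℚ * i ≡ i * x
  lem = solve-∀ ring

B-minus-one : ∀ k → B (- 1ℚ) k ≡ sgn k
B-minus-one zero    = refl
B-minus-one (suc k) = trans (cong (λ x → x * (- 1ℚ - cast k) * invℕ (suc k)) (B-minus-one k))
  (by-cofactor (- sgn k) (inv-* k) (lem (sgn k) (cast k) (invℕ (suc k))))
  where
  lem : ∀ s k i → s * (- 1ℚ - k) * i - (- s) ≡ (- s) * (i * (k + 1ℚ) - 1ℚ)
  lem = solve-∀ ring

C≡B : ∀ n k → cast (n C k) ≡ B (cast n) k
C≡B n       zero    = cong cast (trans (nCk≡nC[n∸k] {0} {n} z≤n) (nCn≡1 n))
C≡B zero    (suc k) = trans (cong cast (k>n⇒nCk≡0 {k = suc k} (s≤s z≤n))) (sym (B0-suc k))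
C≡B (suc n) (suc k) = trans (cong cast (sym (nCk+nC[k+1]≡[n+1]C[k+1] n k)))
  (trans (cast-+ (n C k) (n C suc k)) (trans (cong₂ _+_ (C≡B n k) (C≡B n (suc k)))
  (trans (+-comm (B (cast n) k) _) (sym (B-pascal (cast n) k)))))

-- B a (n − i), with value 0 when i > n.
Bs : ℚ → ℕ → ℕ → ℚ
Bs a n       zero    = B a n
Bs a zero    (suc i) = 0ℚ
Bs a (suc n) (suc i) = Bs a n i

Bs-0 : ∀ a b i → Bs a 0 i ≡ Bs b 0 i
Bs-0 a b zero    = refl
Bs-0 a b (suc i) = refl

Bs-pascal : ∀ a n i → Bs (a + 1ℚ) (suc n) i ≡ Bs a (suc n) i + Bs a n i
Bs-pascal a n       zero    = B-pascal a n
Bs-pascal a zero    (suc i) = trans (Bs-0 _ a i) (sym (+-identityʳ _))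
Bs-pascal a (suc n) (suc i) = Bs-pascal a n i

Bs-> : ∀ a {n i} → n ℕ.< i → Bs a n i ≡ 0ℚ
Bs-> a {zero}  {suc i} _         = refl
Bs-> a {suc n} {suc i} (s≤s n<i) = Bs-> a n<i

Bs-+ : ∀ a i d → Bs a (i ℕ.+ d) i ≡ B a d
Bs-+ a zero    d = refl
Bs-+ a (suc i) d = Bs-+ a i d

-- The value depends only on n - i, and the hypothesis states n - i = k - m without subtraction;
-- both sides are 0 when this difference is negative. It exchanges the pair (index of the
-- polynomial, degree) for the pair (k, m) in which the sums are evaluated.
Bs-shift : ∀ a {n i k m} → n ℕ.+ m ≡ k ℕ.+ i → Bs a n i ≡ Bs a k m
Bs-shift a {n} {i} {k} {m} e with i ℕ.≤? n
... | yes i≤n with d , refl ← ℕ.m≤n⇒∃[o]m+o≡n i≤n =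
  trans (Bs-+ a i d) (sym (trans (cong (λ j → Bs a j m) k≡) (Bs-+ a m d)))
  where
  k≡ : k ≡ m ℕ.+ d
  k≡ = ℕ.+-cancelʳ-≡ i k (m ℕ.+ d) (trans (sym e) (trans (ℕ.+-comm (i ℕ.+ d) m)
         (trans (cong (m ℕ.+_) (ℕ.+-comm i d)) (sym (ℕ.+-assoc m d i)))))
... | no i≰n = trans (Bs-> a (ℕ.≰⇒> i≰n)) (sym (Bs-> a k<m))
  where
  k<m : k ℕ.< m
  k<m = ℕ.+-cancelʳ-< i k m (subst (ℕ._< m ℕ.+ i) e
          (subst (n ℕ.+ m ℕ.<_) (ℕ.+-comm i m) (ℕ.+-monoˡ-< m (ℕ.≰⇒> i≰n))))

-- Alternating sums and harmonic numbers

alternating-sum : ∀ a j → S j (λ m → sgn m * B (a + 1ℚ) (suc m)) ≡ 1ℚ - sgn j * B a j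
alternating-sum a zero    = refl
alternating-sum a (suc j) = trans (cong₂ _+_ (alternating-sum a j) (cong (sgn j *_) (B-pascal a j)))
  (lem (sgn j) (B a j) (B a (suc j)))
  where
  lem : ∀ s x y → 1ℚ - s * x + s * (y + x) ≡ 1ℚ - (- s) * y
  lem = solve-∀ ring

-- Pascal's rule splits C(k+1, m+1) into C(k, m+1), which gives the sum for k, and C(k, m). In the
-- latter, absorption trades the factor 1/(m+1) for 1/(k+1), and what remains is a full alternating
-- row sum, equal to 1.
harmonic-binomial : ∀ k → S k (λ m → sgn m * invℕ (suc m) * B (cast k) (suc m)) ≡ harmonic k
harmonic-binomial zero    = refl
harmonic-binomial (suc k) = begin
  S (suc k) (λ m → sgn m * invℕ (suc m) * B (cast (suc k)) (suc m))
    ≡⟨ S-cong (suc k) (λ m _ → step m) ⟩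
  S (suc k) (λ m → f m + invℕ (suc k) * g m)
    ≡⟨ S-+ (suc k) f _ ⟩
  S (suc k) f + S (suc k) (λ m → invℕ (suc k) * g m)
    ≡⟨ cong₂ _+_ first second ⟩
  harmonic k + invℕ (suc k) ∎
  where
  open ≡-Reasoning
  f g : ℕ → ℚ
  f m = sgn m * invℕ (suc m) * B (cast k) (suc m)
  g m = sgn m * B (cast k + 1ℚ) (suc m)
  lem : ∀ s i j a x y z → j * a ≡ 1ℚ → z ≡ x + y → z ≡ a * y * i → s * i * z ≡ s * i * x + j * (s * z)
  lem s i j a x y z ja≡1 p q = trans (cong (s * i *_) p) (trans (lem₁ s i x y) (cong (s * i * x +_) (trans
      (by-cofactor (- (s * i * y)) ja≡1 (lem₂ s i j a y)) (cong (λ w → j * (s * w)) (sym q)))))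
    where
    lem₁ : ∀ s i x y → s * i * (x + y) ≡ s * i * x + s * i * y
    lem₁ = solve-∀ ring
    lem₂ : ∀ s i j a y → s * i * y - j * (s * (a * y * i)) ≡ - (s * i * y) * (j * a - 1ℚ)
    lem₂ = solve-∀ ring
  step : ∀ m → sgn m * invℕ (suc m) * B (cast (suc k)) (suc m) ≡ f m + invℕ (suc k) * g m
  step m = lem (sgn m) (invℕ (suc m)) (invℕ (suc k)) (cast k + 1ℚ) (B (cast k) (suc m)) (B (cast k) m) _
    (inv-* k) (B-pascal (cast k) m) (B-absorb (cast k) m)
  first : S (suc k) f ≡ harmonic k
  first = trans (cong₂ _+_ (harmonic-binomial k) (trans (cong (sgn k * invℕ (suc k) *_) (B-zero k)) (*-zeroʳ (sgn k * invℕ (suc k)))))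
    (+-identityʳ _)
  second : S (suc k) (λ m → invℕ (suc k) * g m) ≡ invℕ (suc k)
  second = trans (S-* (suc k) (invℕ (suc k)) g) (trans (cong (invℕ (suc k) *_)
    (trans (alternating-sum (cast k) (suc k)) (trans (cong (λ x → 1ℚ - sgn (suc k) * x) (B-zero k)) (lem₃ (sgn (suc k))))))
    (*-identityʳ _))
    where
    lem₃ : ∀ s → 1ℚ - s * 0ℚ ≡ 1ℚ
    lem₃ = solve-∀ ring

-- Multiplication by constants, t and 2 - t on coefficients

constP-0 : ∀ i → constP 0ℚ i ≡ 0ℚ
constP-0 zero    = refl
constP-0 (suc i) = refl

sumℚ-cong : ∀ n {f g} → (∀ j → f j ≡ g j) → sumℚ f n ≡ sumℚ g n
sumℚ-cong zero    h = h 0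
sumℚ-cong (suc n) h = cong₂ _+_ (sumℚ-cong n h) (h (suc n))

sumℚ-0 : ∀ n {f} → (∀ j → f j ≡ 0ℚ) → sumℚ f n ≡ 0ℚ
sumℚ-0 zero    h = h 0
sumℚ-0 (suc n) h = cong₂ _+_ (sumℚ-0 n h) (h (suc n))

sumℚ-first : ∀ f n → sumℚ f (suc n) ≡ f 0 + sumℚ (f ∘ suc) n
sumℚ-first f zero    = refl
sumℚ-first f (suc n) = trans (cong (_+ f (suc (suc n))) (sumℚ-first f n)) (+-assoc (f 0) _ _)

sumℚ-minus : ∀ f g n → sumℚ (λ j → f j - g j) n ≡ sumℚ f n - sumℚ g n
sumℚ-minus f g zero    = refl
sumℚ-minus f g (suc n) = trans (cong (_+ (f (suc n) - g (suc n))) (sumℚ-minus f g n))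
  (lem (sumℚ f n) (sumℚ g n) (f (suc n)) (g (suc n)))
  where
  lem : ∀ x y z w → (x - y) + (z - w) ≡ (x + z) - (y + w)
  lem = solve-∀ ring

constP-*ₚ : ∀ c f i → (constP c *ₚ f) i ≡ c * f i
constP-*ₚ c f zero    = refl
constP-*ₚ c f (suc i) = trans (sumℚ-first (λ j → constP c j * f (suc i ℕ.∸ j)) i)
  (trans (cong (c * f (suc i) +_) (sumℚ-0 i (λ j → *-zeroˡ (f (i ℕ.∸ j))))) (+-identityʳ _))

shift : Poly → Poly
shift f zero    = 0ℚ
shift f (suc i) = f i

T-suc : ∀ j → T (suc j) ≡ constP 1ℚ j
T-suc zero    = refl
T-suc (suc j) = refl

T-*ₚ : ∀ f i → (T *ₚ f) i ≡ shift f i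
T-*ₚ f zero    = *-zeroˡ (f 0)
T-*ₚ f (suc i) = begin
  (T *ₚ f) (suc i)                                              ≡⟨ sumℚ-first (λ j → T j * f (suc i ℕ.∸ j)) i ⟩
  0ℚ * f (suc i) + sumℚ (λ j → T (suc j) * f (i ℕ.∸ j)) i       ≡⟨ cong₂ _+_ (*-zeroˡ (f (suc i))) (sumℚ-cong i (λ j → cong (_* f (i ℕ.∸ j)) (T-suc j))) ⟩
  0ℚ + (constP 1ℚ *ₚ f) i                                       ≡⟨ +-identityˡ ((constP 1ℚ *ₚ f) i) ⟩
  (constP 1ℚ *ₚ f) i                                            ≡⟨ constP-*ₚ 1ℚ f i ⟩
  1ℚ * f i                                                      ≡⟨ *-identityˡ (f i) ⟩
  f i                                                           ∎
  where open ≡-Reasoning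

two-T-*ₚ : ∀ f i → (twoMinusT *ₚ f) i ≡ two * f i - shift f i
two-T-*ₚ f i = trans
  (sumℚ-cong i (λ j → lem (constP two j) (T j) (f (i ℕ.∸ j))))
  (trans (sumℚ-minus (λ j → constP two j * f (i ℕ.∸ j)) (λ j → T j * f (i ℕ.∸ j)) i)
    (cong₂ _-_ (constP-*ₚ two f i) (T-*ₚ f i)))
  where
  lem : ∀ x y z → (x - y) * z ≡ x * z - y * z
  lem = solve-∀ ring

-- Lucas polynomials: recurrences, and v in terms of u

u[2-t] v[2-t] u[t,t] v[t,t] : ℕ → Poly
u[2-t] = u₁ twoMinusT
v[2-t] = v₁ twoMinusT
u[t,t] = uL T T
v[t,t] = vL T T

u[2-t]-rec : ∀ n i → u[2-t] (suc (suc n)) i ≡ two * u[2-t] (suc n) i - shift (u[2-t] (suc n)) i - u[2-t] n i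
u[2-t]-rec n i = cong₂ _-_ (two-T-*ₚ (u[2-t] (suc n)) i) (trans (constP-*ₚ 1ℚ (u[2-t] n) i) (*-identityˡ _))

v[2-t]-rec : ∀ n i → v[2-t] (suc (suc n)) i ≡ two * v[2-t] (suc n) i - shift (v[2-t] (suc n)) i - v[2-t] n i
v[2-t]-rec n i = cong₂ _-_ (two-T-*ₚ (v[2-t] (suc n)) i) (trans (constP-*ₚ 1ℚ (v[2-t] n) i) (*-identityˡ _))

u[t,t]-rec : ∀ n i → u[t,t] (suc (suc n)) i ≡ shift (u[t,t] (suc n)) i - shift (u[t,t] n) i
u[t,t]-rec n i = cong₂ _-_ (T-*ₚ (u[t,t] (suc n)) i) (T-*ₚ (u[t,t] n) i)

v[t,t]-rec : ∀ n i → v[t,t] (suc (suc n)) i ≡ shift (v[t,t] (suc n)) i - shift (v[t,t] n) i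
v[t,t]-rec n i = cong₂ _-_ (T-*ₚ (v[t,t] (suc n)) i) (T-*ₚ (v[t,t] n) i)

shift-combination : ∀ (f g h : Poly) → (∀ i → f i ≡ g i - h i) → ∀ i → shift f i ≡ shift g i - shift h i
shift-combination f g h e zero    = refl
shift-combination f g h e (suc i) = e i

-- The general relation is v_n = u_{n+1} - y u_{n-1}, here with y = 1. Both sides obey the same
-- second-order recurrence, so two consecutive cases are carried through the induction.
v[2-t]≡u-u : ∀ n i → v[2-t] (suc n) i ≡ u[2-t] (suc (suc n)) i - u[2-t] n i
v[2-t]≡u-u n = proj₁ (go n)
  where
  P : ℕ → Set
  P n = ∀ i → v[2-t] (suc n) i ≡ u[2-t] (suc (suc n)) i - u[2-t] n i
  twoMinusT≡ : ∀ i → twoMinusT i ≡ two * constP 1ℚ i - shift (constP 1ℚ) i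
  twoMinusT≡ zero          = refl
  twoMinusT≡ (suc zero)    = refl
  twoMinusT≡ (suc (suc i)) = refl
  p0 : P 0
  p0 i = trans (twoMinusT≡ i) (trans (lem (two * constP 1ℚ i - shift (constP 1ℚ) i) (constP 0ℚ i) (constP-0 i))
     (cong (_- constP 0ℚ i) (sym (u[2-t]-rec 0 i))))
    where
    lem : ∀ x z → z ≡ 0ℚ → x ≡ x - z - z
    lem x z refl = lem′ x
      where
      lem′ : ∀ x → x ≡ x - 0ℚ - 0ℚ
      lem′ = solve-∀ ring
  step : ∀ n → P (suc n) → P n → P (suc (suc n))
  step n h₁ h₀ i = begin
    v[2-t] (suc (suc (suc n))) i ≡⟨ v[2-t]-rec (suc n) i ⟩
    two * v[2-t] (suc (suc n)) i - shift (v[2-t] (suc (suc n))) i - v[2-t] (suc n) i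
      ≡⟨ cong₂ _-_ (cong₂ (λ x y → two * x - y) (h₁ i) (shift-combination (v[2-t] (suc (suc n))) _ _ h₁ i)) (h₀ i) ⟩
    two * (U₃ i - U₁ i) - (shift U₃ i - shift U₁ i) - (U₂ i - u[2-t] n i)
      ≡⟨ lem two (U₃ i) (U₁ i) (shift U₃ i) (shift U₁ i) (U₂ i) (u[2-t] n i) ⟩
    (two * U₃ i - shift U₃ i - U₂ i) - (two * U₁ i - shift U₁ i - u[2-t] n i)
      ≡⟨ sym (cong₂ _-_ (u[2-t]-rec (suc (suc n)) i) (u[2-t]-rec n i)) ⟩
    u[2-t] (suc (suc (suc (suc n)))) i - u[2-t] (suc (suc n)) i ∎
    where
    open ≡-Reasoning
    U₁ U₂ U₃ : Poly
    U₁ = u[2-t] (suc n)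
    U₂ = u[2-t] (suc (suc n))
    U₃ = u[2-t] (suc (suc (suc n)))
    lem : ∀ t a b c d e f → t * (a - b) - (c - d) - (e - f) ≡ (t * a - c - e) - (t * b - d - f)
    lem = solve-∀ ring
  p1 : P 1
  p1 i = begin
    v[2-t] 2 i ≡⟨ v[2-t]-rec 0 i ⟩
    two * v[2-t] 1 i - shift (v[2-t] 1) i - constP two i
      ≡⟨ cong₂ _-_ (cong₂ (λ x y → two * x - y) (p0 i) (shift-combination (v[2-t] 1) _ _ p0 i)) (twoP i) ⟩
    two * (U₂ i - constP 0ℚ i) - (shift U₂ i - shift (constP 0ℚ) i) - (constP 1ℚ i + constP 1ℚ i)
      ≡⟨ lem (two * (U₂ i - constP 0ℚ i)) (shift U₂ i) (shift (constP 0ℚ) i) (constP 1ℚ i) (two * U₂ i) (trans (cong (λ z → two * (U₂ i - z)) (constP-0 i)) (cong (two *_) (+-identityʳ (U₂ i)))) (shiftzero i) ⟩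
    (two * U₂ i - shift U₂ i - constP 1ℚ i) - constP 1ℚ i
      ≡⟨ cong (_- constP 1ℚ i) (sym (u[2-t]-rec 1 i)) ⟩
    u[2-t] 3 i - u[2-t] 1 i ∎
    where
    open ≡-Reasoning
    U₂ : Poly
    U₂ = u[2-t] 2
    twoP : ∀ i → constP two i ≡ constP 1ℚ i + constP 1ℚ i
    twoP zero    = refl
    twoP (suc i) = refl
    shiftzero : ∀ i → shift (constP 0ℚ) i ≡ 0ℚ
    shiftzero zero    = refl
    shiftzero (suc i) = constP-0 i
    lem : ∀ a b c d e → a ≡ e → c ≡ 0ℚ → a - (b - c) - (d + d) ≡ (e - b - d) - d
    lem a b c d e refl refl = lem′ a b d
      where
      lem′ : ∀ a b d → a - (b - 0ℚ) - (d + d) ≡ (a - b - d) - d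
      lem′ = solve-∀ ring
  go : ∀ n → P n × P (suc n)
  go zero    = p0 , p1
  go (suc n) with h₀ , h₁ ← go n = h₁ , step n h₁ h₀

v[t,t]≡u-tu : ∀ n i → v[t,t] (suc n) i ≡ u[t,t] (suc (suc n)) i - shift (u[t,t] n) i
v[t,t]≡u-tu n = proj₁ (go n)
  where
  open ≡-Reasoning
  P : ℕ → Set
  P n = ∀ i → v[t,t] (suc n) i ≡ u[t,t] (suc (suc n)) i - shift (u[t,t] n) i
  shift0 : ∀ i → shift (constP 0ℚ) i ≡ 0ℚ
  shift0 zero          = refl
  shift0 (suc zero)    = refl
  shift0 (suc (suc i)) = refl
  T≡shift : ∀ i → T i ≡ shift (constP 1ℚ) i
  T≡shift zero    = refl
  T≡shift (suc i) = T-suc i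
  p0 : P 0
  p0 i = begin
    T i                                                            ≡⟨ T≡shift i ⟩
    shift (constP 1ℚ) i                                            ≡⟨ lem (shift (constP 1ℚ) i) (shift (constP 0ℚ) i) (shift0 i) ⟩
    shift (constP 1ℚ) i - shift (constP 0ℚ) i - shift (constP 0ℚ) i ≡⟨ cong (_- shift (constP 0ℚ) i) (sym (u[t,t]-rec 0 i)) ⟩
    u[t,t] 2 i - shift (constP 0ℚ) i                               ∎
    where
    lem : ∀ x z → z ≡ 0ℚ → x ≡ x - z - z
    lem x z refl = lem′ x
      where
      lem′ : ∀ x → x ≡ x - 0ℚ - 0ℚ
      lem′ = solve-∀ ring
  p1 : P 1
  p1 zero    = trans (v[t,t]-rec 0 0) (cong (_- 0ℚ) (sym (u[t,t]-rec 1 0)))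
  p1 (suc i) = begin
    v[t,t] 2 (suc i)                                  ≡⟨ v[t,t]-rec 0 (suc i) ⟩
    T i - constP two i                                ≡⟨ cong₂ _-_ (p0 i) (two≡ i) ⟩
    (U₂ i - shift (constP 0ℚ) i) - (constP 1ℚ i + constP 1ℚ i)
      ≡⟨ lem (U₂ i) (shift (constP 0ℚ) i) (constP 1ℚ i) (shift0 i) ⟩
    (U₂ i - constP 1ℚ i) - constP 1ℚ i                ≡⟨ cong (_- constP 1ℚ i) (sym (u[t,t]-rec 1 (suc i))) ⟩
    u[t,t] 3 (suc i) - constP 1ℚ i                    ∎
    where
    U₂ : Poly
    U₂ = u[t,t] 2
    two≡ : ∀ i → constP two i ≡ constP 1ℚ i + constP 1ℚ i
    two≡ zero    = refl
    two≡ (suc i) = refl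
    lem : ∀ x z d → z ≡ 0ℚ → (x - z) - (d + d) ≡ (x - d) - d
    lem x z d refl = lem′ x d
      where
      lem′ : ∀ x d → (x - 0ℚ) - (d + d) ≡ (x - d) - d
      lem′ = solve-∀ ring
  step : ∀ n → P (suc n) → P n → P (suc (suc n))
  step n h₁ h₀ zero    = trans (v[t,t]-rec (suc n) 0) (cong (_- 0ℚ) (sym (u[t,t]-rec (suc (suc n)) 0)))
  step n h₁ h₀ (suc i) = begin
    v[t,t] (suc (suc (suc n))) (suc i)          ≡⟨ v[t,t]-rec (suc n) (suc i) ⟩
    v[t,t] (suc (suc n)) i - v[t,t] (suc n) i   ≡⟨ cong₂ _-_ (h₁ i) (h₀ i) ⟩
    (U₃ i - shift U₁ i) - (U₂ i - shift (u[t,t] n) i) ≡⟨ lem (U₃ i) (shift U₁ i) (U₂ i) (shift (u[t,t] n) i) ⟩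
    (U₃ i - U₂ i) - (shift U₁ i - shift (u[t,t] n) i)
      ≡⟨ sym (cong₂ _-_ (u[t,t]-rec (suc (suc n)) (suc i)) (u[t,t]-rec n i)) ⟩
    u[t,t] (suc (suc (suc (suc n)))) (suc i) - u[t,t] (suc (suc n)) i ∎
    where
    U₁ U₂ U₃ : Poly
    U₁ = u[t,t] (suc n)
    U₂ = u[t,t] (suc (suc n))
    U₃ = u[t,t] (suc (suc (suc n)))
    lem : ∀ a b c d → (a - b) - (c - d) ≡ (a - c) - (b - d)
    lem = solve-∀ ring
  go : ∀ n → P n × P (suc n)
  go zero    = p0 , p1
  go (suc n) with h₀ , h₁ ← go n = h₁ , step n h₁ h₀

-- Coefficients of the Lucas polynomials as binomials

-- Upper negation of the familiar (-1)^i C(n+i+1, n-i). In this form the upper argument is free of n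
-- and equals 2k - 2p when i + k = p - 1. Passing to degree i - 1 raises it by 2, so the recurrence
-- is Pascal's rule applied twice.
u[2-t]-coeff : ∀ n i → u[2-t] (suc n) i ≡ sgn n * Bs (- (two * cast (suc i))) n i
u[2-t]-coeff n = proj₁ (go n)
  where
  open ≡-Reasoning
  P : ℕ → Set
  P n = ∀ i → u[2-t] (suc n) i ≡ sgn n * Bs (- (two * cast (suc i))) n i
  arg : ∀ i → - (two * cast (suc i)) ≡ - (two * cast (suc (suc i))) + 1ℚ + 1ℚ
  arg i = lem (cast i)
    where
    lem : ∀ x → - (two * (x + 1ℚ)) ≡ - (two * (x + 1ℚ + 1ℚ)) + 1ℚ + 1ℚ
    lem = solve-∀ ring
  p0 : P 0
  p0 zero    = refl
  p0 (suc i) = refl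
  p1 : P 1
  p1 zero          = refl
  p1 (suc zero)    = refl
  p1 (suc (suc i)) = trans (u[2-t]-rec 0 (suc (suc i))) refl
  step : ∀ n → P (suc n) → P n → P (suc (suc n))
  step n h₁ h₀ i = begin
    u[2-t] (suc (suc (suc n))) i ≡⟨ u[2-t]-rec (suc n) i ⟩
    two * u[2-t] (suc (suc n)) i - shift (u[2-t] (suc (suc n))) i - u[2-t] (suc n) i
      ≡⟨ cong₂ _-_ (cong₂ (λ x y → two * x - y) (h₁ i) (shifted i)) (h₀ i) ⟩
    two * (- sgn n * b (suc n)) - (- sgn n * bb) - sgn n * b n
      ≡⟨ lem (sgn n) (b n) (b (suc n)) (b (suc (suc n))) bb (bb≡ i) ⟩
    - (- sgn n) * b (suc (suc n)) ∎
    where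
    b : ℕ → ℚ
    b m = Bs (- (two * cast (suc i))) m i
    bb : ℚ
    bb = Bs (- (two * cast (suc i)) + 1ℚ + 1ℚ) (suc (suc n)) i
    bb≡ : ∀ i → Bs (- (two * cast (suc i)) + 1ℚ + 1ℚ) (suc (suc n)) i
        ≡ (Bs (- (two * cast (suc i))) (suc (suc n)) i + Bs (- (two * cast (suc i))) (suc n) i)
          + (Bs (- (two * cast (suc i))) (suc n) i + Bs (- (two * cast (suc i))) n i)
    bb≡ i = trans (Bs-pascal _ (suc n) i) (cong₂ _+_ (Bs-pascal _ (suc n) i) (Bs-pascal _ n i))
    shifted : ∀ i → shift (u[2-t] (suc (suc n))) i ≡ - sgn n * Bs (- (two * cast (suc i)) + 1ℚ + 1ℚ) (suc (suc n)) i
    -- The constant coefficient of a shift is 0, and so is the binomial: its upper argument -2 + 1 +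
    -- 1 is 0.
    shifted zero    = sym (trans (cong (- sgn n *_) (B0-suc (suc n))) (*-zeroʳ (- sgn n)))
    shifted (suc i) = trans (h₁ i) (cong (λ a → - sgn n * Bs a (suc n) i) (arg i))
    lem : ∀ s x y z w → w ≡ (z + y) + (y + x) → two * (- s * y) - (- s * w) - s * x ≡ - (- s) * z
    lem s x y z w refl = lem′ s x y z
      where
      lem′ : ∀ s x y z → two * (- s * y) - (- s * ((z + y) + (y + x))) - s * x ≡ - (- s) * z
      lem′ = solve-∀ ring
  go : ∀ n → P n × P (suc n)
  go zero    = p0 , p1
  go (suc n) with h₀ , h₁ ← go n = h₁ , step n h₁ h₀

-- Upper negation of (-1)^(n-i) C(i, n-i). Here the upper argument grows by 1 with n, so the
-- recurrence is a single use of Pascal's rule.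
u[t,t]-coeff : ∀ n i → u[t,t] (suc n) i ≡ Bs (cast n - 1ℚ - two * cast i) n i
u[t,t]-coeff n = proj₁ (go n)
  where
  open ≡-Reasoning
  P : ℕ → Set
  P n = ∀ i → u[t,t] (suc n) i ≡ Bs (cast n - 1ℚ - two * cast i) n i
  p0 : P 0
  p0 zero    = refl
  p0 (suc i) = refl
  p1 : P 1
  p1 zero          = refl
  p1 (suc zero)    = refl
  p1 (suc (suc i)) = u[t,t]-rec 0 (suc (suc i))
  step : ∀ n → P (suc n) → P n → P (suc (suc n))
  step n h₁ h₀ zero    = begin
    u[t,t] (suc (suc (suc n))) 0 ≡⟨ u[t,t]-rec (suc n) 0 ⟩
    0ℚ - 0ℚ                      ≡⟨ sym (B-zero (suc n)) ⟩
    B (cast (suc n)) (suc (suc n)) ≡⟨ cong (λ a → B a (suc (suc n))) (lem (cast n)) ⟩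
    B (cast (suc (suc n)) - 1ℚ - two * 0ℚ) (suc (suc n)) ∎
    where
    lem : ∀ x → x + 1ℚ ≡ x + 1ℚ + 1ℚ - 1ℚ - two * 0ℚ
    lem = solve-∀ ring
  step n h₁ h₀ (suc i) = begin
    u[t,t] (suc (suc (suc n))) (suc i) ≡⟨ u[t,t]-rec (suc n) (suc i) ⟩
    u[t,t] (suc (suc n)) i - u[t,t] (suc n) i ≡⟨ cong₂ _-_ (h₁ i) (h₀ i) ⟩
    Bs (cast (suc n) - 1ℚ - two * cast i) (suc n) i - Bs a n i
      ≡⟨ cong (λ c → Bs c (suc n) i - Bs a n i) (lem (cast n) (two * cast i)) ⟩
    Bs (a + 1ℚ) (suc n) i - Bs a n i ≡⟨ cong (_- Bs a n i) (Bs-pascal a n i) ⟩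
    Bs a (suc n) i + Bs a n i - Bs a n i ≡⟨ lem₂ (Bs a (suc n) i) (Bs a n i) ⟩
    Bs a (suc n) i ≡⟨ cong (λ c → Bs c (suc n) i) (lem₃ (cast n) (cast i)) ⟩
    Bs (cast (suc (suc n)) - 1ℚ - two * cast (suc i)) (suc n) i ∎
    where
    a : ℚ
    a = cast n - 1ℚ - two * cast i
    lem : ∀ n x → n + 1ℚ - 1ℚ - x ≡ (n - 1ℚ - x) + 1ℚ
    lem = solve-∀ ring
    lem₂ : ∀ x y → x + y - y ≡ x
    lem₂ = solve-∀ ring
    lem₃ : ∀ n x → n - 1ℚ - two * x ≡ n + 1ℚ + 1ℚ - 1ℚ - two * (x + 1ℚ)
    lem₃ = solve-∀ ring
  go : ∀ n → P n × P (suc n)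
  go zero    = p0 , p1
  go (suc n) with h₀ , h₁ ← go n = h₁ , step n h₁ h₀

-- In u_{n+2} - u_n the lower indices differ by 2. Adding and subtracting the binomial between them
-- lets Pascal's rule raise the upper argument to the odd number -2i - 1, leaving a difference of
-- two neighbours in one row.
v[2-t]-coeff : ∀ n i → v[2-t] (suc n) i
             ≡ - (sgn n * (Bs (- (two * cast i) - 1ℚ) (suc n) i - Bs (- (two * cast i) - 1ℚ) n i))
v[2-t]-coeff n i = begin
  v[2-t] (suc n) i                                     ≡⟨ v[2-t]≡u-u n i ⟩
  u[2-t] (suc (suc n)) i - u[2-t] n i                   ≡⟨ cong (_- u[2-t] n i) (u[2-t]-coeff (suc n) i) ⟩
  - sgn n * Bs α (suc n) i - u[2-t] n i                 ≡⟨ step n ⟩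
  - (sgn n * (Bs (α + 1ℚ) (suc n) i - Bs (α + 1ℚ) n i)) ≡⟨ cong (λ a → - (sgn n * (Bs a (suc n) i - Bs a n i))) (lem (cast i)) ⟩
  - (sgn n * (Bs β (suc n) i - Bs β n i)) ∎
  where
  open ≡-Reasoning
  α β : ℚ
  α = - (two * cast (suc i))
  β = - (two * cast i) - 1ℚ
  lem : ∀ x → - (two * (x + 1ℚ)) + 1ℚ ≡ - (two * x) - 1ℚ
  lem = solve-∀ ring
  lem₀ : ∀ s x y → - s * x - 0ℚ ≡ - (s * (x + y - y))
  lem₀ = solve-∀ ring
  lem₁ : ∀ s x y z → - (- s) * x - s * z ≡ - (- s * (x + y - (y + z)))
  lem₁ = solve-∀ ring
  step : ∀ n → - sgn n * Bs α (suc n) i - u[2-t] n i ≡ - (sgn n * (Bs (α + 1ℚ) (suc n) i - Bs (α + 1ℚ) n i))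
  step zero    = trans (cong (λ x → - 1ℚ * Bs α 1 i - x) (constP-0 i)) (trans (lem₀ 1ℚ (Bs α 1 i) (Bs α 0 i))
    (cong₂ (λ x y → - (1ℚ * (x - y))) (sym (Bs-pascal α 0 i)) (Bs-0 α (α + 1ℚ) i)))
  step (suc n) = trans (cong (λ x → - (- sgn n) * Bs α (suc (suc n)) i - x) (u[2-t]-coeff n i))
    (trans (lem₁ (sgn n) (Bs α (suc (suc n)) i) (Bs α (suc n) i) (Bs α n i))
    (cong₂ (λ x y → - (- sgn n * (x - y))) (sym (Bs-pascal α (suc n) i)) (sym (Bs-pascal α n i))))

v[t,t]-coeff-0 : ∀ n → v[t,t] (suc n) 0 ≡ 0ℚ
v[t,t]-coeff-0 zero    = refl
v[t,t]-coeff-0 (suc n) = v[t,t]-rec n 0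

v[t,t]-coeff : ∀ n i → v[t,t] (suc n) (suc i)
             ≡ Bs (cast n - two * cast (suc i)) n i - Bs (cast n - two * cast (suc i)) n (suc i)
v[t,t]-coeff n i = begin
  v[t,t] (suc n) (suc i)                   ≡⟨ v[t,t]≡u-tu n (suc i) ⟩
  u[t,t] (suc (suc n)) (suc i) - u[t,t] n i ≡⟨ cong (_- u[t,t] n i) (u[t,t]-coeff (suc n) (suc i)) ⟩
  Bs (cast (suc n) - 1ℚ - two * cast (suc i)) n i - u[t,t] n i
    ≡⟨ cong (λ a → Bs a n i - u[t,t] n i) (lem₁ (cast n) (two * cast (suc i))) ⟩
  Bs (cast n - two * cast (suc i)) n i - u[t,t] n i ≡⟨ cong (λ x → Bs (cast n - two * cast (suc i)) n i - x) (step n) ⟩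
  Bs (cast n - two * cast (suc i)) n i - Bs (cast n - two * cast (suc i)) n (suc i) ∎
  where
  open ≡-Reasoning
  lem₁ : ∀ x y → x + 1ℚ - 1ℚ - y ≡ x - y
  lem₁ = solve-∀ ring
  lem₂ : ∀ x y → x - 1ℚ - two * y ≡ x + 1ℚ - two * (y + 1ℚ)
  lem₂ = solve-∀ ring
  step : ∀ n → u[t,t] n i ≡ Bs (cast n - two * cast (suc i)) n (suc i)
  step zero    = constP-0 i
  step (suc n) = trans (u[t,t]-coeff n i) (cong (λ a → Bs a n i) (lem₂ (cast n) (cast i)))

-- Denominators, parity, and Landen's identity

denominator-∣ : ∀ r g n → ↧ r ℤ.* g ≡ ℤ.+ n → ↧ₙ r ∣ n
denominator-∣ r g n e = divides ℤ.∣ g ∣ (trans (sym (cong ℤ.∣_∣ e)) (trans (ℤ.abs-* (↧ r) g) (ℕ.*-comm (↧ₙ r) ℤ.∣ g ∣)))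

sgn-parity : ∀ n → (sgn n ≡ 1ℚ × 2 ∣ n) ⊎ (sgn n ≡ - 1ℚ × 2 ∣ suc n)
sgn-parity zero    = inj₁ (refl , divides 0 refl)
sgn-parity (suc n) with sgn-parity n
... | inj₁ (e , divides j refl) = inj₂ (cong -_ e , divides (suc j) refl)
... | inj₂ (e , d) = inj₁ (cong -_ e , d)

-- Upper negation C(-M, d) = (-1)^d C(M+d-1, d), combined with (M+d) C(M+d-1, d) = M C(M+d, M). This
-- places the binomial in row M + d, where `harmonic-binomial` applies.
neg-binomial : ∀ M d → cast (d ℕ.+ M) * B (- cast M) d ≡ sgn d * (cast M * B (cast (d ℕ.+ M)) M)
neg-binomial M zero    = trans (lem (cast M)) (cong (λ x → 1ℚ * (cast M * x)) (sym (B-diag M)))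
  where
  lem : ∀ x → x * 1ℚ ≡ 1ℚ * (x * 1ℚ)
  lem = solve-∀ ring
neg-binomial M (suc d) = go (cast (d ℕ.+ M)) (cast-+ d M) (neg-binomial M d) (B-upper (cast (d ℕ.+ M)) M)
  where
  lem : ∀ d m s i x y z → (d + m + 1ℚ) * (x * (- m - d) * i) - (- s) * (m * z)
      ≡ - (d + m + 1ℚ) * i * ((d + m) * x - s * (m * y))
      + s * m * i * ((d + m + 1ℚ - m) * z - (d + m + 1ℚ) * y) + - (s * m * z) * (i * (d + 1ℚ) - 1ℚ)
  lem = solve-∀ ring
  go : ∀ n → n ≡ cast d + cast M → n * B (- cast M) d ≡ sgn d * (cast M * B n M)
    → (n + 1ℚ - cast M) * B (n + 1ℚ) M ≡ (n + 1ℚ) * B n M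
    → (n + 1ℚ) * (B (- cast M) d * (- cast M - cast d) * invℕ (suc d)) ≡ - sgn d * (cast M * B (n + 1ℚ) M)
  go n refl h₁ h₂ = by-cofactors
    (- (n + 1ℚ) * invℕ (suc d) ⊡ h₁ ⊞ sgn d * cast M * invℕ (suc d) ⊡ h₂ ⊞ - (sgn d * cast M * B (n + 1ℚ) M) ⊡ inv-* d)
    (lem (cast d) (cast M) (sgn d) (invℕ (suc d)) (B (- cast M) d) (B n M) (B (n + 1ℚ) M))

-- The coefficientwise form of Landen's identity Li₂(−z) + Li₂(z/(1+z)) = −½ log²(1+z).
landen : ∀ k → S (suc k) (λ m → invℕ (suc m) * invℕ (suc m) * Bs (- cast (suc m)) k m)
             ≡ sgn k * invℕ (suc k) * harmonic (suc k)
landen k = begin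
  S (suc k) (λ m → invℕ (suc m) * invℕ (suc m) * Bs (- cast (suc m)) k m)
    ≡⟨ S-cong (suc k) (λ m m<sk → term m (ℕ.s≤s⁻¹ m<sk)) ⟩
  S (suc k) (λ m → sgn k * invℕ (suc k) * (sgn m * invℕ (suc m) * B (cast (suc k)) (suc m)))
    ≡⟨ S-* (suc k) (sgn k * invℕ (suc k)) _ ⟩
  sgn k * invℕ (suc k) * S (suc k) (λ m → sgn m * invℕ (suc m) * B (cast (suc k)) (suc m))
    ≡⟨ cong (sgn k * invℕ (suc k) *_) (harmonic-binomial (suc k)) ⟩
  sgn k * invℕ (suc k) * harmonic (suc k) ∎
  where
  open ≡-Reasoning
  lem : ∀ sd sm im ik M n x y → im * im * x - sd * sm * ik * (sm * im * y)
      ≡ im * im * ik * (n * x - sd * (M * y)) + - (im * im * x) * (ik * n - 1ℚ)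
      + im * ik * sd * y * (im * M - 1ℚ) + - (sd * ik * im * y) * (sm * sm - 1ℚ)
  lem = solve-∀ ring
  term : ∀ m → m ℕ.≤ k → invℕ (suc m) * invℕ (suc m) * Bs (- cast (suc m)) k m
       ≡ sgn k * invℕ (suc k) * (sgn m * invℕ (suc m) * B (cast (suc k)) (suc m))
  -- With d = k - m, `neg-binomial` at M = m + 1 always lands in row k + 1, whatever m is; the sign
  -- (-1)^d becomes (-1)^k (-1)^m.
  term m m≤k with d , refl ← ℕ.m≤n⇒∃[o]m+o≡n m≤k =
    trans (cong (im * im *_) (Bs-+ (- cast (suc m)) m d))
    (trans (by-cofactors (im * im * ik ⊡ h ⊞ - (im * im * x) ⊡ inv-* (m ℕ.+ d) ⊞ im * ik * sgn d * y ⊡ inv-* m ⊞ - (sgn d * ik * im * y) ⊡ sgn² m)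
      (lem (sgn d) (sgn m) im ik (cast (suc m)) (cast (suc (m ℕ.+ d))) x y))
      (cong (λ s → s * ik * (sgn m * im * y))
        (trans (*-comm (sgn d) (sgn m)) (sym (sgn-+ m d)))))
    where
    im ik x y : ℚ
    im = invℕ (suc m)
    ik = invℕ (suc (m ℕ.+ d))
    x  = B (- cast (suc m)) d
    y  = B (cast (suc (m ℕ.+ d))) (suc m)
    h : cast (suc (m ℕ.+ d)) * B (- cast (suc m)) d ≡ sgn d * (cast (suc m) * B (cast (suc (m ℕ.+ d))) (suc m))
    h = subst (λ n → cast n * B (- cast (suc m)) d ≡ sgn d * (cast (suc m) * B (cast n) (suc m)))
          (trans (ℕ.+-suc d m) (cong suc (ℕ.+-comm d m))) (neg-binomial (suc m) d)

S-delta : ∀ {N k} (f : ℕ → ℚ) → k ℕ.< N → S N (λ m → f m * Bs 0ℚ k m) ≡ f k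
S-delta {N} {k} f k<N = trans (S-single (λ m → f m * Bs 0ℚ k m) k<N (λ m _ → off m))
  (trans (cong (f k *_) (diag k)) (*-identityʳ (f k)))
  where
  diag : ∀ k → Bs 0ℚ k k ≡ 1ℚ
  diag zero    = refl
  diag (suc k) = diag k
  off-diag : ∀ {m k} → m ≢ k → Bs 0ℚ k m ≡ 0ℚ
  off-diag {zero}  {zero}  m≢k = contradiction refl m≢k
  off-diag {zero}  {suc k} m≢k = B0-suc k
  off-diag {suc m} {zero}  m≢k = refl
  off-diag {suc m} {suc k} m≢k = off-diag (m≢k ∘ cong suc)
  off : ∀ m → m ≢ k → f m * Bs 0ℚ k m ≡ 0ℚ
  off m m≢k = trans (cong (f m *_) (off-diag m≢k)) (*-zeroʳ (f m))

landen-long : ∀ {N k} → k ℕ.< N → S N (λ m → invℕ (suc m) * invℕ (suc m) * Bs (- cast (suc m)) k m)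
            ≡ sgn k * invℕ (suc k) * harmonic (suc k)
landen-long {N} {k} k<N = trans (S-tail _ k<N vanish) (landen k)
  where
  vanish : ∀ m → k ℕ.< m → invℕ (suc m) * invℕ (suc m) * Bs (- cast (suc m)) k m ≡ 0ℚ
  vanish m k<m = trans (cong (invℕ (suc m) * invℕ (suc m) *_) (Bs-> (- cast (suc m)) k<m)) (*-zeroʳ (invℕ (suc m) * invℕ (suc m)))

+1-swap : ∀ a x → a + 1ℚ - x ≡ a - x + 1ℚ
+1-swap = solve-∀ ring

B-pascal-minus : ∀ a x k → B (a + 1ℚ - x) (suc k) ≡ B (a - x) (suc k) + B (a - x) k
B-pascal-minus a x k = trans (cong (λ c → B c (suc k)) (+1-swap a x)) (B-pascal (a - x) k)

-- Coefficients of sums, and coefficients beyond the degree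

sumP₀≡S : ∀ b F i → sumP 0 b F i ≡ S (suc b) (λ k → F k i)
sumP₀≡S zero    F i = refl
sumP₀≡S (suc b) F i = cong (_+ F (suc b) i) (sumP₀≡S b F i)

sumP₁≡S : ∀ b F i → sumP 1 b F i ≡ S b (λ m → F (suc m) i)
sumP₁≡S zero    F i = refl
sumP₁≡S (suc b) F i = cong (_+ F (suc b) i) (sumP₁≡S b F i)

tPow-≡ : ∀ k → tPow k k ≡ 1ℚ
tPow-≡ k with k ℕ.≟ k
... | yes _  = refl
... | no k≢k = contradiction refl k≢k

tPow-≢ : ∀ {k i} → k ≢ i → tPow k i ≡ 0ℚ
tPow-≢ {k} {i} k≢i with k ℕ.≟ i
... | yes k≡i = contradiction k≡i k≢i
... | no _    = refl

Bs-diag : ∀ a n → Bs a n n ≡ 1ℚ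
Bs-diag a zero    = refl
Bs-diag a (suc n) = Bs-diag a n

u[2-t]-high : ∀ {n i} → n ℕ.≤ i → u[2-t] n i ≡ 0ℚ
u[2-t]-high {zero}  {i} _   = constP-0 i
u[2-t]-high {suc n} {i} n<i = trans (u[2-t]-coeff n i) (trans (cong (sgn n *_) (Bs-> _ n<i)) (*-zeroʳ (sgn n)))

u[t,t]-high : ∀ {n i} → n ℕ.≤ i → u[t,t] n i ≡ 0ℚ
u[t,t]-high {zero}  {i} _   = constP-0 i
u[t,t]-high {suc n} {i} n<i = trans (u[t,t]-coeff n i) (Bs-> _ n<i)

v[2-t]-high : ∀ {n i} → suc n ℕ.< i → v[2-t] (suc n) i ≡ 0ℚ
v[2-t]-high {n} {i} n<i = trans (v[2-t]-coeff n i)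
  (trans (cong₂ (λ x y → - (sgn n * (x - y))) (Bs-> _ n<i) (Bs-> _ (ℕ.<⇒≤ n<i))) (lem (sgn n)))
  where
  lem : ∀ s → - (s * (0ℚ - 0ℚ)) ≡ 0ℚ
  lem = solve-∀ ring

v[t,t]-high : ∀ {n i} → suc n ℕ.< i → v[t,t] (suc n) i ≡ 0ℚ
v[t,t]-high {n} {suc i} (s≤s n<i) = trans (v[t,t]-coeff n i) (cong₂ _-_ (Bs-> _ n<i) (Bs-> _ (ℕ.m<n⇒m<1+n n<i)))

v[2-t]-coeff-0 : ∀ n → v[2-t] (suc n) 0 ≡ two
v[2-t]-coeff-0 n = trans (v[2-t]-coeff n 0)
  (trans (cong₂ (λ x y → - (sgn n * (x - y))) (B-minus-one (suc n)) (B-minus-one n))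
    (by-cofactor two (sgn² n) (lem (sgn n))))
  where
  lem : ∀ s → - (s * (- s - s)) - two ≡ two * (s * s - 1ℚ)
  lem = solve-∀ ring

-- Central binomial coefficients

-- Halving moves the upper argument to 2k + 1, the one that also occurs, shifted by p and 2p, in the
-- coefficients of v_p.
central : ∀ k → ℕ→ℚ ((2 ℕ.* suc k) C suc k) ≡ two * B (cast (suc (2 ℕ.* k))) k
central k = begin
  ℕ→ℚ ((2 ℕ.* suc k) C suc k)          ≡⟨ ℕ→ℚ≡cast ((2 ℕ.* suc k) C suc k) ⟩
  cast ((2 ℕ.* suc k) C suc k)         ≡⟨ C≡B (2 ℕ.* suc k) (suc k) ⟩
  B (cast (2 ℕ.* suc k)) (suc k)       ≡⟨ cong (λ n → B (cast n) (suc k)) (cong suc (ℕ.+-suc k (k ℕ.+ 0))) ⟩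
  B (a + 1ℚ) (suc k)                   ≡⟨ B-absorb a k ⟩
  (a + 1ℚ) * B a k * invℕ (suc k)      ≡⟨ cong (λ x → (x + 1ℚ + 1ℚ) * B a k * invℕ (suc k)) (cast-double k) ⟩
  (two * cast k + 1ℚ + 1ℚ) * B a k * invℕ (suc k)
    ≡⟨ by-cofactor (two * B a k) (inv-* k) (lem (cast k) (B a k) (invℕ (suc k))) ⟩
  two * B a k ∎
  where
  open ≡-Reasoning
  a : ℚ
  a = cast (suc (2 ℕ.* k))
  lem : ∀ k b i → (two * k + 1ℚ + 1ℚ) * b * i - two * b ≡ two * b * (i * (k + 1ℚ) - 1ℚ)
  lem = solve-∀ ring

-- The identity C(2k−1, k−m) − C(2k−1, k−m−1) = (m/k) C(2k, k−m) for k = suc k′ and m = suc m′.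
central-difference : ∀ k m → let a = cast (suc (2 ℕ.* k)) in
  invℕ (suc m) * (Bs a (suc k) (suc m) - Bs a k (suc m)) ≡ invℕ (suc k) * Bs (a + 1ℚ) (suc k) (suc m)
central-difference k m with ℕ.<-cmp k m
... | tri< k<m _ _ = trans (cong₂ (λ x y → invℕ (suc m) * (x - y)) (Bs-> a k<m) (Bs-> a (ℕ.m<n⇒m<1+n k<m)))
    (trans (lem (invℕ (suc m)) (invℕ (suc k))) (cong (invℕ (suc k) *_) (sym (Bs-> (a + 1ℚ) k<m))))
  where
  a : ℚ
  a = cast (suc (2 ℕ.* k))
  lem : ∀ i j → i * (0ℚ - 0ℚ) ≡ j * 0ℚ
  lem = solve-∀ ring
... | tri≈ _ refl _ = trans (cong₂ (λ x y → invℕ (suc m) * (x - y)) (Bs-diag a k) (Bs-> a (ℕ.n<1+n k)))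
    (cong (invℕ (suc k) *_) (sym (Bs-diag (a + 1ℚ) k)))
  where
  a : ℚ
  a = cast (suc (2 ℕ.* k))
... | tri> _ _ m<k with d , refl ← ℕ.m≤n⇒∃[o]m+o≡n m<k =
  trans (cong₂ (λ x y → invℕ (suc m) * (x - y)) (Bs≡ a) (Bs-+ a (suc m) d))
  (trans (step (cast-+ (suc m) d) (cong (_+ 1ℚ) (cast-double k)) (inv-* k))
  (cong (invℕ (suc k) *_) (trans (sym (B-absorb a d)) (sym (Bs≡ (a + 1ℚ))))))
  where
  a : ℚ
  a = cast (suc (2 ℕ.* k))
  lem : ∀ im ik j m d x → im * (x * (two * (m + d) + 1ℚ - d) * j - x) - ik * ((two * (m + d) + 1ℚ + 1ℚ) * x * j)
      ≡ im * x * (j * (d + 1ℚ) - 1ℚ) + two * x * j * (im * m - 1ℚ) + - (two * x * j) * (ik * (m + d + 1ℚ) - 1ℚ)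
  lem = solve-∀ ring
  step : ∀ {c a} → c ≡ cast (suc m) + cast d → a ≡ two * c + 1ℚ → invℕ (suc k) * (c + 1ℚ) ≡ 1ℚ
    → invℕ (suc m) * (B a (suc d) - B a d) ≡ invℕ (suc k) * ((a + 1ℚ) * B a d * invℕ (suc d))
  step {c} {a} refl refl h = by-cofactors
    (invℕ (suc m) * B a d ⊡ inv-* d ⊞ two * B a d * invℕ (suc d) ⊡ inv-* m ⊞ - (two * B a d * invℕ (suc d)) ⊡ h)
    (lem (invℕ (suc m)) (invℕ (suc k)) (invℕ (suc d)) (cast (suc m)) (cast d) (B a d))
  Bs≡ : ∀ a → Bs a (suc (m ℕ.+ d)) m ≡ B a (suc d)
  Bs≡ a = trans (cong (λ n → Bs a n m) (sym (ℕ.+-suc m d))) (Bs-+ a m (suc d))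

-- Pascal's rule makes the sum telescope; the far end `Bs a k N` vanishes because k < N.
alternating-central : ∀ {k N} a → k ℕ.< N → S N (λ m → sgn (suc m) * Bs (a + 1ℚ) (suc k) (suc m)) ≡ - B a k
alternating-central {k} {N} a k<N = trans (telescope N)
  (trans (cong (λ x → sgn N * x - B a k) (Bs-> a k<N)) (lem₀ (sgn N) (B a k)))
  where
  lem₀ : ∀ s b → s * 0ℚ - b ≡ - b
  lem₀ = solve-∀ ring
  lem₁ : ∀ b → 0ℚ ≡ 1ℚ * b - b
  lem₁ = solve-∀ ring
  lem₂ : ∀ s x y b → s * x - b + - s * (x + y) ≡ - s * y - b
  lem₂ = solve-∀ ring
  telescope : ∀ N → S N (λ m → sgn (suc m) * Bs (a + 1ℚ) (suc k) (suc m)) ≡ sgn N * Bs a k N - B a k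
  telescope zero    = lem₁ (B a k)
  telescope (suc N) = trans (cong₂ (λ x y → x + - sgn N * y) (telescope N) (Bs-pascal a k (suc N)))
    (lem₂ (sgn N) (Bs a k N) (Bs a k (suc N)) (B a k))

-- The bound on N keeps every m at most q, where the truncated q ∸ m is injective, so that m = k
-- alone contributes.
S-tPow : ∀ {q N} (c : ℕ → ℚ) {i k} → N ℕ.≤ suc q → i ℕ.+ k ≡ q → k ℕ.< N → S N (λ m → c m * tPow (q ℕ.∸ m) i) ≡ c k
S-tPow {q} {N} c {i} {k} N≤ refl k<N = trans (S-single _ k<N off)
  (trans (cong (λ j → c k * tPow j i) (ℕ.m+n∸n≡m i k)) (trans (cong (c k *_) (tPow-≡ i)) (*-identityʳ (c k))))
  where
  off : ∀ m → m ℕ.< N → m ≢ k → c m * tPow (i ℕ.+ k ℕ.∸ m) i ≡ 0ℚ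
  off m m<N m≢k = trans (cong (c m *_) (tPow-≢ λ e → m≢k
    (ℕ.+-cancelˡ-≡ i m k (trans (cong (ℕ._+ m) (sym e)) (ℕ.m∸n+n≡m (ℕ.s≤s⁻¹ (ℕ.≤-trans m<N N≤)))))))
    (*-zeroʳ (c m))

S-tPow-none : ∀ q N (c : ℕ → ℚ) {i} → (∀ m → m ℕ.< N → q ℕ.∸ m ≢ i) → S N (λ m → c m * tPow (q ℕ.∸ m) i) ≡ 0ℚ
S-tPow-none q N c h = S-0 _ (λ m m<N → trans (cong (c m *_) (tPow-≢ (h m m<N))) (*-zeroʳ (c m)))

-- p-integral rationals and congruences modulo powers of p

module p-adic (q : ℕ) (p-prime : Prime (suc q)) (3<p : 3 ℕ.< suc q) where

  p : ℕ
  p = suc q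

  π : ℚ
  π = cast p

  sgn-q : sgn q ≡ 1ℚ
  sgn-q with sgn-parity q
  ... | inj₁ (e , _) = e
  ... | inj₂ (_ , d) = contradiction (prime⇒irreducible p-prime d)
          [ (λ ()) , (λ 2≡p → ℕ.<⇒≢ (ℕ.<-trans (s≤s (s≤s (s≤s z≤n))) 3<p) 2≡p) ]

  sgn-reverse : ∀ n m → n ℕ.+ m ≡ q → sgn n ≡ sgn m
  sgn-reverse n m refl = inverse-unique (trans (sym (sgn-+ n m)) sgn-q) (sgn² m)

  -- A record around `InZp`, which unfolds to a negation from which r could not be inferred.
  record Zp (r : ℚ) : Set where
    constructor integral
    field inZp : InZp p r

  open Zp

  -- The reduced denominator of r divides the product of those of a and b, g being the factor lost
  -- in reduction; Euclid's lemma does the rest.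
  Zp-by : ∀ {a b} r g → ↧ r ℤ.* g ≡ ↧ a ℤ.* ↧ b → Zp a → Zp b → Zp r
  Zp-by {a} {b} r g e za zb .inZp p∣r =
    [ inZp za , inZp zb ] (euclidsLemma (↧ₙ a) (↧ₙ b) p-prime
      (∣-trans p∣r (denominator-∣ r g (↧ₙ a ℕ.* ↧ₙ b) (trans e (sym (ℤ.pos-* (↧ₙ a) (↧ₙ b)))))))

  Zp-+ : ∀ {a b} → Zp a → Zp b → Zp (a + b)
  Zp-+ {a} {b} = Zp-by (a + b) _ (↧-+ a b)

  Zp-* : ∀ {a b} → Zp a → Zp b → Zp (a * b)
  Zp-* {a} {b} = Zp-by (a * b) _ (↧-* a b)

  Zp-neg : ∀ {a} → Zp a → Zp (- a)
  Zp-neg {a} za .inZp = inZp za ∘ subst (p ∣_) (ℤ.+-injective (↧-neg a))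

  Zp-minus : ∀ {a b} → Zp a → Zp b → Zp (a - b)
  Zp-minus za zb = Zp-+ za (Zp-neg zb)

  p∤1 : p ∤ 1
  p∤1 p∣1 = ℕ.<⇒≢ (ℕ.<-trans (s≤s (s≤s z≤n)) 3<p) (sym (∣1⇒≡1 p∣1))

  Zp-0 : Zp 0ℚ
  Zp-0 = integral p∤1

  Zp-1 : Zp 1ℚ
  Zp-1 = integral p∤1

  Zp-cast : ∀ n → Zp (cast n)
  Zp-cast zero    = Zp-0
  Zp-cast (suc n) = Zp-+ (Zp-cast n) Zp-1

  Zp-two : Zp two
  Zp-two = Zp-cast 2

  Zp-inv : ∀ {k} → k ℕ.< q → Zp (invℕ (suc k))
  Zp-inv {k} k<q .inZp p∣ =
    ℕ.<⇒≱ (s≤s k<q) (∣⇒≤ (∣-trans p∣ (denominator-∣ (invℕ (suc k)) _ (suc k) (↧-/ ℤ.1ℤ (suc k)))))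

  Zp-sgn : ∀ n → Zp (sgn n)
  Zp-sgn zero    = Zp-1
  Zp-sgn (suc n) = Zp-neg (Zp-sgn n)

  Zp-S : ∀ N {f} → (∀ m → m ℕ.< N → Zp (f m)) → Zp (S N f)
  Zp-S zero    h = Zp-0
  Zp-S (suc N) h = Zp-+ (Zp-S N (λ m m<N → h m (ℕ.m<n⇒m<1+n m<N))) (h N ℕ.≤-refl)

  Zp-B : ∀ {a} → Zp a → ∀ {k} → k ℕ.≤ q → Zp (B a k)
  Zp-B za {zero}  k≤q = Zp-1
  Zp-B za {suc k} k<q = Zp-* (Zp-* (Zp-B za (ℕ.<⇒≤ k<q)) (Zp-minus za (Zp-cast k))) (Zp-inv k<q)

  Zp-Bs : ∀ {a} → Zp a → ∀ {k} → k ℕ.≤ q → ∀ m → Zp (Bs a k m)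
  Zp-Bs za         k≤q zero    = Zp-B za k≤q
  Zp-Bs za {zero}  k≤q (suc m) = Zp-0
  Zp-Bs za {suc k} k<q (suc m) = Zp-Bs za (ℕ.<⇒≤ k<q) m

  pow : ℕ → ℚ
  pow zero    = 1ℚ
  pow (suc m) = π * pow m

  record D (m : ℕ) (x : ℚ) : Set where
    constructor multiple
    field
      quotient : ℚ
      zp       : Zp quotient
      equation : x ≡ pow m * quotient

  D⇒InPmZp : ∀ m {x} → D m x → InPmZp p m x
  D⇒InPmZp m (multiple r zr e) = r , inZp zr , trans e (cong (_* r) (sym (trans (ℕ→ℚ≡cast (p ℕ.^ m)) (cast-pow m))))
    where
    cast-pow : ∀ m → cast (p ℕ.^ m) ≡ pow m
    cast-pow zero    = refl
    cast-pow (suc m) = trans (cast-* p (p ℕ.^ m)) (cong (π *_) (cast-pow m))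

  D-0 : ∀ {m} → D m 0ℚ
  D-0 {m} = multiple 0ℚ Zp-0 (sym (*-zeroʳ (pow m)))

  D-≡ : ∀ {m x y} → x ≡ y → D m y → D m x
  D-≡ refl d = d

  D-+ : ∀ {m x y} → D m x → D m y → D m (x + y)
  D-+ {m} (multiple r zr e) (multiple s zs f) = multiple (r + s) (Zp-+ zr zs) (trans (cong₂ _+_ e f) (sym (*-distribˡ-+ (pow m) r s)))

  D-* : ∀ {m c x} → Zp c → D m x → D m (c * x)
  D-* {m} {c} zc (multiple r zr e) = multiple (c * r) (Zp-* zc zr) (trans (cong (c *_) e) (lem c (pow m) r))
    where
    lem : ∀ c π r → c * (π * r) ≡ π * (c * r)
    lem = solve-∀ ring

  D-neg : ∀ {m x} → D m x → D m (- x)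
  D-neg {m} {x} d = D-≡ (lem x) (D-* (Zp-neg Zp-1) d)
    where
    lem : ∀ x → - x ≡ - 1ℚ * x
    lem = solve-∀ ring

  D-minus : ∀ {m x y} → D m x → D m y → D m (x - y)
  D-minus d e = D-+ d (D-neg e)

  D-π : ∀ {m x} → D m x → D (suc m) (π * x)
  D-π {m} (multiple r zr e) = multiple r zr (trans (cong (π *_) e) (sym (*-assoc π (pow m) r)))

  D-Zp : ∀ {x} → Zp x → D 0 x
  D-Zp {x} zx = multiple x zx (sym (*-identityˡ x))

  D-weaken : ∀ {m x} → D (suc m) x → D m x
  D-weaken {m} (multiple r zr e) = multiple (π * r) (Zp-* (Zp-cast p) zr) (trans e (lem π (pow m) r))
    where
    lem : ∀ p w r → p * w * r ≡ w * (p * r)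
    lem = solve-∀ ring

  D-inv : ∀ {m x} → D (suc m) x → D m (invℕ p * x)
  D-inv {m} (multiple r zr e) = multiple r zr (trans (cong (invℕ p *_) e)
    (by-cofactor (pow m * r) (inv-* q) (lem (invℕ p) π (pow m) r)))
    where
    lem : ∀ i p w r → i * (p * w * r) - w * r ≡ w * r * (i * p - 1ℚ)
    lem = solve-∀ ring

  D-cancel : ∀ {m x} → D (suc m) (π * x) → D m x
  D-cancel {m} {x} d = D-≡ (by-cofactor (- x) (inv-* q) (lem (invℕ p) π x)) (D-inv d)
    where
    lem : ∀ i p x → x - i * (p * x) ≡ - x * (i * p - 1ℚ)
    lem = solve-∀ ring

  D-S-minus : ∀ {m} N {f g} → (∀ j → j ℕ.< N → D m (f j - g j)) → D m (S N f - S N g)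
  D-S-minus {m} zero    h = D-0
  D-S-minus     (suc N) {f} {g} h = D-≡ (lem (S N f) (f N) (S N g) (g N))
      (D-+ (D-S-minus N (λ m m<N → h m (ℕ.m<n⇒m<1+n m<N))) (h N ℕ.≤-refl))
    where
    lem : ∀ x y z w → x + y - (z + w) ≡ (x - z) + (y - w)
    lem = solve-∀ ring

  D-*-minus : ∀ {m x x′ y y′} → Zp x → Zp y′ → D m (x - x′) → D m (y - y′) → D m (x * y - x′ * y′)
  D-*-minus {m} {x} {x′} {y} {y′} zx zy′ dx dy = D-≡ (lem x x′ y y′) (D-+ (D-* zx dy) (D-* zy′ dx))
    where
    lem : ∀ x x′ y y′ → x * y - x′ * y′ ≡ x * (y - y′) + y′ * (x - x′)
    lem = solve-∀ ring

  D-refl : ∀ {m} x → D m (x - x)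
  D-refl {m} x = D-≡ (+-inverseʳ x) D-0

  -- The bound k ≤ p - 1 keeps the divisions by 1, ..., k inside ℤ_(p).
  B-cong : ∀ {a b} → Zp a → Zp b → D 1 (a - b) → ∀ {k} → k ℕ.≤ q → D 1 (B a k - B b k)
  B-cong         za zb d {zero}  k≤q = D-refl 1ℚ
  B-cong {a} {b} za zb d {suc k} k<q =
    D-*-minus (Zp-* (Zp-B za (ℕ.<⇒≤ k<q)) (Zp-minus za (Zp-cast k))) (Zp-inv k<q)
      (D-*-minus (Zp-B za (ℕ.<⇒≤ k<q)) (Zp-minus zb (Zp-cast k)) (B-cong za zb d (ℕ.<⇒≤ k<q))
        (D-≡ (lem a b (cast k)) d))
      (D-refl (invℕ (suc k)))
    where
    lem : ∀ a b k → (a - k) - (b - k) ≡ a - b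
    lem = solve-∀ ring

  Bs-cong : ∀ {a b} → Zp a → Zp b → D 1 (a - b) → ∀ {k} → k ℕ.≤ q → ∀ m → D 1 (Bs a k m - Bs b k m)
  Bs-cong za zb d         k≤q zero    = B-cong za zb d k≤q
  Bs-cong za zb d {zero}  k≤q (suc m) = D-refl 0ℚ
  Bs-cong za zb d {suc k} k<q (suc m) = Bs-cong za zb d (ℕ.<⇒≤ k<q) m

  D-S : ∀ {m} N {f} → (∀ j → j ℕ.< N → D m (f j)) → D m (S N f)
  D-S zero    h = D-0
  D-S (suc N) h = D-+ (D-S N (λ m m<N → h m (ℕ.m<n⇒m<1+n m<N))) (h N ℕ.≤-refl)

  Zp-π : Zp π
  Zp-π = Zp-cast p

  D-ππ : ∀ {x} → Zp x → D 2 (π * (π * x))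
  D-ππ zx = D-π (D-π (D-Zp zx))

  -- The sum of inverse squares modulo p

  -- Two relations modulo p² between H = Σ 1/m and H₂ = Σ 1/m² are played against each other: 2H ≡
  -- -pH₂ from pairing m with p - m, and H ≡ pH₂ from `harmonic-binomial` in row p. Hence 3pH₂ ≡ 0,
  -- and 3 is invertible because p > 3.
  wolstenholme : D 1 (S q (λ m → invℕ (suc m) * invℕ (suc m)))
  wolstenholme = D-≡ (by-cofactor (- H₂) (inv-* 2) (lem₅ (invℕ 3) H₂)) (D-* (Zp-inv (ℕ.s≤s⁻¹ 3<p))
      (D-cancel (D-≡ (lem₄ H H₂ π) (D-minus pairing (D-* Zp-two via-binomials)))))
    where
    H H₂ : ℚ
    H = harmonic q
    H₂ = S q (λ m → invℕ (suc m) * invℕ (suc m))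
    lem₄ : ∀ h h₂ p → p * (three * h₂) ≡ two * h + p * h₂ - two * (h - p * h₂)
    lem₄ = solve-∀ ring
    lem₅ : ∀ i h → h - i * (three * h) ≡ (- h) * (i * three - 1ℚ)
    lem₅ = solve-∀ ring
    pairing : D 2 (two * H + π * H₂)
    pairing = D-≡ total (D-S q (λ m m<q → D-ππ (Zp-* (Zp-* (Zp-inv m<q) (Zp-inv m<q)) (Zp-inv (reversed< m<q)))))
      where
      open ≡-Reasoning
      reversed< : ∀ {m} → m ℕ.< q → q ℕ.∸ suc m ℕ.< q
      reversed< {m} m<q = ℕ.∸-monoʳ-< (s≤s z≤n) m<q
      i j : ℕ → ℚ
      i m = invℕ (suc m)
      j m = invℕ (suc (q ℕ.∸ suc m))
      lem : ∀ x y i j → i + j + (x + y) * (i * i) - (x + y) * ((x + y) * (i * i * j))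
          ≡ - (i + j * (1ℚ + i * x)) * (i * x - 1ℚ) + - (y * (i * i) + two * i * (i * x)) * (j * y - 1ℚ)
      lem = solve-∀ ring
      split : ∀ h h₂ p → two * h + p * h₂ ≡ h + h + p * h₂
      split = solve-∀ ring
      -- With i = 1/x, j = 1/y and x + y = p one has i + j = pij, so i + j + pi² = pi(i + j) =
      -- p²i²j.
      term : ∀ m → m ℕ.< q → i m + j m + π * (i m * i m) ≡ π * (π * (i m * i m * j m))
      term m m<q = subst (λ p → i m + j m + p * (i m * i m) ≡ p * (p * (i m * i m * j m))) π≡
        (by-cofactors (- (i m + j m * (1ℚ + i m * x)) ⊡ inv-* m ⊞ - (y * (i m * i m) + two * i m * (i m * x)) ⊡ inv-* (q ℕ.∸ suc m)) (lem x y (i m) (j m)))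
        where
        x y : ℚ
        x = cast (suc m)
        y = cast (suc (q ℕ.∸ suc m))
        π≡ : cast (suc m) + cast (suc (q ℕ.∸ suc m)) ≡ π
        π≡ = trans (sym (cast-+ (suc m) (suc (q ℕ.∸ suc m))))
               (cong cast (trans (ℕ.+-suc (suc m) _) (cong suc (ℕ.m+[n∸m]≡n m<q))))
      total : two * H + π * H₂ ≡ S q (λ m → π * (π * (i m * i m * j m)))
      total = begin
        two * H + π * H₂                             ≡⟨ split H H₂ π ⟩
        H + H + π * H₂                               ≡⟨ cong₂ (λ x y → H + x + y) (S-reverse q i) (sym (S-* q π _)) ⟩
        S q i + S q j + S q (λ m → π * (i m * i m))  ≡⟨ cong (_+ S q (λ m → π * (i m * i m))) (sym (S-+ q i j)) ⟩
        S q (λ m → i m + j m) + S q (λ m → π * (i m * i m)) ≡⟨ sym (S-+ q (λ m → i m + j m) _) ⟩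
        S q (λ m → i m + j m + π * (i m * i m))      ≡⟨ S-cong q term ⟩
        S q (λ m → π * (π * (i m * i m * j m)))      ∎
    via-binomials : D 2 (H - π * H₂)
    via-binomials = D-≡ (cong₂ _-_ H≡ (sym (S-* q π _)))
      (D-S-minus q (λ m m<q → D-≡ (term m) (D-π (D-* (Zp-* (Zp-* (Zp-inv m<q) (Zp-inv m<q)) (Zp-sgn m))
        (B≡sgn (ℕ.<⇒≤ m<q))))))
      where
      f : ℕ → ℚ
      f m = sgn m * invℕ (suc m) * B π (suc m)
      H≡ : H ≡ S q f
      -- In row p both sides of `harmonic-binomial` end with the term 1/p. Cancelling it removes the
      -- only denominator divisible by p.
      H≡ = by-cofactors (1ℚ ⊡ sym (harmonic-binomial p) ⊞ 1ℚ ⊡ last)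
             (lem H (S q f) (invℕ p) (f q))
        where
        last : f q ≡ invℕ p
        last = trans (cong₂ (λ s b → s * invℕ p * b) sgn-q (B-diag p)) (lem′ (invℕ p))
          where
          lem′ : ∀ x → 1ℚ * x * 1ℚ ≡ x
          lem′ = solve-∀ ring
        lem : ∀ h s i l → h - s ≡ 1ℚ * (h + i - (s + l)) + 1ℚ * (l - i)
        lem = solve-∀ ring
      B≡sgn : ∀ {m} → m ℕ.≤ q → D 1 (B (cast q) m - sgn m)
      B≡sgn {m} m≤q = D-≡ (cong (λ x → B (cast q) m - x) (sym (B-minus-one m)))
        -- p - 1 ≡ -1 modulo p, and C(-1, m) = (-1)^m.
        (B-cong (Zp-cast q) (Zp-neg Zp-1) (D-≡ (lem (cast q)) (D-π (D-Zp Zp-1))) m≤q)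
        where
        lem : ∀ x → x - (- 1ℚ) ≡ (x + 1ℚ) * 1ℚ
        lem = solve-∀ ring
      term : ∀ m → f m - π * (invℕ (suc m) * invℕ (suc m))
           ≡ π * (invℕ (suc m) * invℕ (suc m) * sgn m * (B (cast q) m - sgn m))
      term m = trans (cong (λ b → sgn m * i * b - π * (i * i)) (B-absorb (cast q) m))
        (by-cofactors (π * (i * i) ⊡ sgn² m) (lem (sgn m) i (cast q + 1ℚ) (B (cast q) m)))
        where
        i : ℚ
        i = invℕ (suc m)
        lem : ∀ s i p b → s * i * (p * b * i) - p * (i * i) - p * (i * i * s * (b - s)) ≡ p * (i * i) * (s * s - 1ℚ)
        lem = solve-∀ ring

  -- First and second differences of binomials in steps of p

  -- Multiples of p^m are closed under addition, so divisibility spreads along Pascal's rule from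
  -- row 0. The rule never raises k, so the bound k ≤ p - 1 survives.
  pascal-induction : ∀ {m} (φ : ℚ → ℕ → ℚ) → (∀ a → φ (a + 1ℚ) 0 ≡ φ a 0) → (∀ a k → φ (a + 1ℚ) (suc k) ≡ φ a (suc k) + φ a k)
    → (∀ k → k ℕ.≤ q → D m (φ 0ℚ k)) → ∀ n k → k ℕ.≤ q → D m (φ (cast n) k)
  pascal-induction φ h₀ h base zero    k       k≤q = base k k≤q
  pascal-induction φ h₀ h base (suc n) zero    k≤q = D-≡ (h₀ (cast n)) (pascal-induction φ h₀ h base n zero k≤q)
  pascal-induction φ h₀ h base (suc n) (suc k) k≤q = D-≡ (h (cast n) k)
    (D-+ (pascal-induction φ h₀ h base n (suc k) k≤q) (pascal-induction φ h₀ h base n k (ℕ.<⇒≤ k≤q)))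

  Zp-harmonic : ∀ {k} → k ℕ.≤ q → Zp (harmonic k)
  Zp-harmonic {k} k≤q = Zp-S k (λ m m<k → Zp-inv (ℕ.<-≤-trans m<k k≤q))

  -- Passing from k + 1 to k + 2 multiplies by (-x - (k+1))/(k+2). The factor k + 1 carries the old
  -- terms over, -x times the linear term adds 1/(k+1) to the harmonic number, and -x times the
  -- quadratic term is of order x³.
  B-expansion : ∀ {x} → Zp x → D 1 x → ∀ {k} → k ℕ.< q
    → D 3 (B (- x) (suc k) + sgn k * (invℕ (suc k) * (x + x * x * harmonic k)))
  B-expansion {x} zx dx {zero}  k<q = D-≡ (lem x) D-0
    where
    lem : ∀ x → 1ℚ * (- x - 0ℚ) * 1ℚ + 1ℚ * (1ℚ * (x + x * x * 0ℚ)) ≡ 0ℚ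
    lem = solve-∀ ring
  B-expansion {x} zx dx@(multiple y zy x≡) {suc k} k<q =
    D-≡ (by-cofactor (sgn k * i′ * (x + x * x * harmonic k)) (inv-* k)
          (lem x (cast (suc k)) i i′ (sgn k) (harmonic k) (B (- x) (suc k))))
      (D-+ (D-* (Zp-* (Zp-minus (Zp-neg zx) (Zp-cast (suc k))) (Zp-inv k<q)) (B-expansion zx dx (ℕ.<⇒≤ k<q)))
           (D-* (Zp-* (Zp-* (Zp-* (Zp-sgn k) (Zp-inv k<q)) (Zp-inv (ℕ.<⇒≤ k<q))) (Zp-harmonic (ℕ.<⇒≤ (ℕ.<⇒≤ k<q)))) cube))
    where
    i i′ : ℚ
    i  = invℕ (suc k)
    i′ = invℕ (suc (suc k))
    cube : D 3 (x * x * x)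
    cube = multiple (y * y * y) (Zp-* (Zp-* zy zy) zy) (trans (cong (λ z → z * z * z) x≡) (lem₃ π y))
      where
      lem₃ : ∀ p y → p * 1ℚ * y * (p * 1ℚ * y) * (p * 1ℚ * y) ≡ p * (p * (p * 1ℚ)) * (y * y * y)
      lem₃ = solve-∀ ring
    lem : ∀ x c i i′ s h b → b * (- x - c) * i′ + - s * (i′ * (x + x * x * (h + i)))
          - ((- x - c) * i′ * (b + s * (i * (x + x * x * h))) + s * i′ * i * h * (x * x * x))
        ≡ s * i′ * (x + x * x * h) * (i * c - 1ℚ)
    lem = solve-∀ ring

  D1-π : D 1 π
  D1-π = D-≡ (sym (*-identityʳ π)) (D-π (D-Zp Zp-1))

  expand : ∀ k → ℚ → ℚ
  expand k x = B (- x) (suc k) + sgn k * (invℕ (suc k) * (x + x * x * harmonic k))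

  D-expand-π : ∀ {k} → k ℕ.< q → D 3 (expand k π)
  D-expand-π k<q = B-expansion Zp-π D1-π k<q

  D-expand-2π : ∀ {k} → k ℕ.< q → D 3 (expand k (two * π))
  D-expand-2π k<q = B-expansion (Zp-* Zp-two Zp-π) (D-* Zp-two D1-π) k<q

  -- The summand (u_n(2-t) + u_n(t,t))/n² for n = p - (m+1), reduced mod p. Summed over m it gives,
  -- for k < p, the coefficient of z^k in (1+z)^a (Li₂(-z) + Li₂(z/(1+z))).
  bracket : ℚ → ℕ → ℕ → ℚ
  bracket a k m = invℕ (suc m) * invℕ (suc m) * (sgn (suc m) * Bs a k (suc m) + Bs (a - cast (suc m)) k (suc m))

  second-difference-error : ℚ → ℕ → ℚ
  second-difference-error a k = B a k - two * B (a - π) k + B (a - two * π) k + two * (π * π * S q (bracket a k))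

  second-difference-error-cast : ∀ n k → k ℕ.≤ q → D 3 (second-difference-error (cast n) k)
  second-difference-error-cast = pascal-induction second-difference-error second-difference-error-0 second-difference-error-suc second-difference-error-base
    where
    S-bracket-0 : ∀ a → S q (bracket a 0) ≡ 0ℚ
    S-bracket-0 a = S-0 q (λ m _ → lem (invℕ (suc m)) (sgn (suc m)))
      where
      lem : ∀ i s → i * i * (s * 0ℚ + 0ℚ) ≡ 0ℚ
      lem = solve-∀ ring
    second-difference-error-0 : ∀ a → second-difference-error (a + 1ℚ) 0 ≡ second-difference-error a 0
    second-difference-error-0 a = cong (λ x → 1ℚ - two * 1ℚ + 1ℚ + two * (π * π * x)) (trans (S-bracket-0 (a + 1ℚ)) (sym (S-bracket-0 a)))
    S-bracket-suc : ∀ a k → S q (bracket (a + 1ℚ) (suc k)) ≡ S q (bracket a (suc k)) + S q (bracket a k)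
    S-bracket-suc a k = trans (S-cong q (λ m _ → term m)) (S-+ q (bracket a (suc k)) (bracket a k))
      where
      lem : ∀ i s w x y z → i * (s * (w + x) + (y + z)) ≡ i * (s * w + y) + i * (s * x + z)
      lem = solve-∀ ring
      term : ∀ m → bracket (a + 1ℚ) (suc k) m ≡ bracket a (suc k) m + bracket a k m
      term m = trans (cong₂ (λ x y → invℕ (suc m) * invℕ (suc m) * (sgn (suc m) * x + y))
          (Bs-pascal a k (suc m))
          (trans (cong (λ c → Bs c (suc k) (suc m)) (+1-swap a (cast (suc m)))) (Bs-pascal (a - cast (suc m)) k (suc m))))
        (lem (invℕ (suc m) * invℕ (suc m)) (sgn (suc m)) _ _ _ _)
    second-difference-error-suc : ∀ a k → second-difference-error (a + 1ℚ) (suc k) ≡ second-difference-error a (suc k) + second-difference-error a k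
    second-difference-error-suc a k = trans (cong₂ (λ x y → x + two * (π * π * y))
        (cong₂ _+_ (cong₂ (λ x y → x - two * y) (B-pascal a k) (B-pascal-minus a π k)) (B-pascal-minus a (two * π) k))
        (S-bracket-suc a k))
      (lem (π * π) (B a (suc k)) (B a k) (B (a - π) (suc k)) (B (a - π) k)
        (B (a - two * π) (suc k)) (B (a - two * π) k) (S q (bracket a (suc k))) (S q (bracket a k)))
      where
      lem : ∀ r x x′ y y′ z z′ w w′ → x + x′ - two * (y + y′) + (z + z′) + two * (r * (w + w′))
          ≡ (x - two * y + z + two * (r * w)) + (x′ - two * y′ + z′ + two * (r * w′))
      lem = solve-∀ ring
    S-bracket-base : ∀ {k} → k ℕ.< q → S q (bracket 0ℚ (suc k)) ≡ sgn k * invℕ (suc k) * harmonic k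
    S-bracket-base {k} k<q = trans (S-cong q (λ m _ → split m)) (trans (S-+ q (λ m → invℕ (suc m) * invℕ (suc m) * sgn (suc m) * Bs 0ℚ k m) _)
        -- The diagonal term -(-1)^k/(k+1)² removes the last summand of H_{k+1} in Landen's identity
        -- and leaves H_k, as in `B-expansion`.
        (trans (cong₂ _+_ (S-delta (λ m → invℕ (suc m) * invℕ (suc m) * sgn (suc m)) k<q) (landen-long k<q))
          (lem (sgn k) (invℕ (suc k)) (harmonic k))))
      where
      lem : ∀ s i h → i * i * (- s) + s * i * (h + i) ≡ s * i * h
      lem = solve-∀ ring
      distrib : ∀ i s x y → i * (s * x + y) ≡ i * s * x + i * y
      distrib = solve-∀ ring
      split : ∀ m → bracket 0ℚ (suc k) m ≡ invℕ (suc m) * invℕ (suc m) * sgn (suc m) * Bs 0ℚ k m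
                                         + invℕ (suc m) * invℕ (suc m) * Bs (- cast (suc m)) k m
      split m = trans (cong (λ c → invℕ (suc m) * invℕ (suc m) * (sgn (suc m) * Bs 0ℚ k m + Bs c k m)) (+-identityˡ (- cast (suc m))))
        (distrib (invℕ (suc m) * invℕ (suc m)) (sgn (suc m)) _ _)
    second-difference-error-base : ∀ k → k ℕ.≤ q → D 3 (second-difference-error 0ℚ k)
    second-difference-error-base zero    _   = D-≡ (trans (cong (λ x → 1ℚ - two * 1ℚ + 1ℚ + two * (π * π * x)) (S-bracket-0 0ℚ)) (lem (π * π))) D-0
      where
      lem : ∀ x → 1ℚ - two * 1ℚ + 1ℚ + two * (x * 0ℚ) ≡ 0ℚ
      lem = solve-∀ ring
    -- Between x = 2p and twice x = p the linear terms cancel, and the quadratic ones leave 4p² -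
    -- 2p² = 2p²: the origin of the factor 2p² in the first congruence.
    second-difference-error-base (suc k) k<q = D-≡ eq (D-minus (D-expand-2π k<q) (D-* Zp-two (D-expand-π k<q)))
      where
      lem : ∀ x y s i h p → 0ℚ - two * x + y + two * (p * p * (s * i * h))
          ≡ y + s * (i * (two * p + two * p * (two * p) * h)) - two * (x + s * (i * (p + p * p * h)))
      lem = solve-∀ ring
      eq : second-difference-error 0ℚ (suc k) ≡ expand k (two * π) - two * expand k π
      eq = trans (cong₂ (λ x y → x + two * (π * π * y))
          (cong₂ _+_ (cong₂ (λ x y → x - two * y) (B0-suc k) (cong (λ c → B c (suc k)) (+-identityˡ (- π))))
            (cong (λ c → B c (suc k)) (+-identityˡ (- (two * π)))))
          (S-bracket-base k<q))
        (lem (B (- π) (suc k)) (B (- (two * π)) (suc k)) (sgn k) (invℕ (suc k)) (harmonic k) π)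

  -- Summed over m, the coefficient of z^k in -(1+z)^a log(1+z), for k < p.
  log-term : ℚ → ℕ → ℕ → ℚ
  log-term a k m = sgn (suc m) * invℕ (suc m) * Bs a k (suc m)

  first-difference-error : ℚ → ℕ → ℚ
  first-difference-error a k = B (a - two * π) k - B (a - π) k - π * S q (log-term a k)

  first-difference-error-cast : ∀ n k → k ℕ.≤ q → D 2 (first-difference-error (cast n) k)
  first-difference-error-cast = pascal-induction first-difference-error first-difference-error-0 first-difference-error-suc first-difference-error-base
    where
    S-log-0 : ∀ a → S q (log-term a 0) ≡ 0ℚ
    S-log-0 a = S-0 q (λ m _ → *-zeroʳ (sgn (suc m) * invℕ (suc m)))
    first-difference-error-0 : ∀ a → first-difference-error (a + 1ℚ) 0 ≡ first-difference-error a 0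
    first-difference-error-0 a = cong (λ x → 1ℚ - 1ℚ - π * x) (trans (S-log-0 (a + 1ℚ)) (sym (S-log-0 a)))
    S-log-suc : ∀ a k → S q (log-term (a + 1ℚ) (suc k)) ≡ S q (log-term a (suc k)) + S q (log-term a k)
    S-log-suc a k = trans (S-cong q (λ m _ → trans (cong (sgn (suc m) * invℕ (suc m) *_) (Bs-pascal a k (suc m)))
      (*-distribˡ-+ (sgn (suc m) * invℕ (suc m)) _ _))) (S-+ q (log-term a (suc k)) (log-term a k))
    first-difference-error-suc : ∀ a k → first-difference-error (a + 1ℚ) (suc k) ≡ first-difference-error a (suc k) + first-difference-error a k
    first-difference-error-suc a k = trans (cong₂ (λ x y → x - π * y)
        (cong₂ _-_ (B-pascal-minus a (two * π) k) (B-pascal-minus a π k)) (S-log-suc a k))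
      (lem π (B (a - two * π) (suc k)) (B (a - two * π) k) (B (a - π) (suc k)) (B (a - π) k)
        (S q (log-term a (suc k))) (S q (log-term a k)))
      where
      lem : ∀ p x x′ y y′ z z′ → x + x′ - (y + y′) - p * (z + z′) ≡ (x - y - p * z) + (x′ - y′ - p * z′)
      lem = solve-∀ ring
    first-difference-error-base : ∀ k → k ℕ.≤ q → D 2 (first-difference-error 0ℚ k)
    first-difference-error-base zero    _   = D-≡ (trans (cong (λ x → 1ℚ - 1ℚ - π * x) (S-log-0 0ℚ)) (lem π)) D-0
      where
      lem : ∀ x → 1ℚ - 1ℚ - x * 0ℚ ≡ 0ℚ
      lem = solve-∀ ring
    -- The quadratic terms at 2p and p differ by 4p² - p² = 3p² times an element of ℤ_(p), which is
    -- negligible modulo p².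
    first-difference-error-base (suc k) k<q = D-≡ eq
      (D-minus (D-minus (D-weaken (D-expand-2π k<q)) (D-weaken (D-expand-π k<q)))
        (D-ππ (Zp-* Zp-three (Zp-* (Zp-* (Zp-sgn k) (Zp-inv k<q)) (Zp-harmonic (ℕ.<⇒≤ k<q))))))
      where
      Zp-three : Zp three
      Zp-three = Zp-cast 3
      lem : ∀ x y s i h p → y - x - p * (- s * i)
          ≡ (y + s * (i * (two * p + two * p * (two * p) * h))) - (x + s * (i * (p + p * p * h))) - p * (p * (three * (s * i * h)))
      lem = solve-∀ ring
      eq : first-difference-error 0ℚ (suc k) ≡ expand k (two * π) - expand k π - π * (π * (three * (sgn k * invℕ (suc k) * harmonic k)))
      eq = trans (cong₂ (λ x y → x - π * y)
          (cong₂ _-_ (cong (λ c → B c (suc k)) (+-identityˡ (- (two * π)))) (cong (λ c → B c (suc k)) (+-identityˡ (- π))))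
          (S-delta (λ m → sgn (suc m) * invℕ (suc m)) k<q))
        (lem (B (- π) (suc k)) (B (- (two * π)) (suc k)) (sgn k) (invℕ (suc k)) (harmonic k) π)

  -- The substitution n = p - m in the sums

  -- Because of the index shift, the hypothesis says (n+1) + (m+1) = p. Then i + j = pij for the two
  -- inverses, so i² - j² = pij(i - j).
  inv²-reverse : ∀ n m → n ℕ.+ suc m ≡ q → D 1 (invℕ (suc n ℕ.* suc n) - invℕ (suc m) * invℕ (suc m))
  inv²-reverse n m e = D-≡ (trans (cong (_- j * j) (inv-homo-* n n)) factor)
      (D-π (D-Zp (Zp-* (Zp-* zi zj) (Zp-minus zi zj))))
    where
    i j x y : ℚ
    i = invℕ (suc n)
    j = invℕ (suc m)
    x = cast (suc n)
    y = cast (suc m)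
    zi : Zp i
    zi = Zp-inv (subst (n ℕ.<_) e (ℕ.m<m+n n (s≤s z≤n)))
    zj : Zp j
    zj = Zp-inv (subst (suc m ℕ.≤_) e (ℕ.m≤n+m (suc m) n))
    lem : ∀ i j x y → i * i - j * j - (x + y) * (i * j * (i - j)) ≡ - (j * (i - j)) * (i * x - 1ℚ) + - (i * (i - j)) * (j * y - 1ℚ)
    lem = solve-∀ ring
    factor : i * i - j * j ≡ π * (i * j * (i - j))
    factor = subst (λ p → i * i - j * j ≡ p * (i * j * (i - j)))
      (trans (sym (cast-+ (suc n) (suc m))) (cong (cast ∘ suc) e))
      (by-cofactors (- (j * (i - j)) ⊡ inv-* n ⊞ - (i * (i - j)) ⊡ inv-* m) (lem i j x y))

  D-S-reverse : ∀ {f g : ℕ → ℚ} → (∀ n m → n ℕ.+ suc m ≡ q → D 1 (f n - g m)) → (∀ m → m ℕ.< q → Zp (g m))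
    → D 1 (S q (λ n → invℕ (suc n ℕ.* suc n) * f n) - S q (λ m → invℕ (suc m) * invℕ (suc m) * g m))
  D-S-reverse {f} {g} d zg = D-≡ (cong (_- S q (λ m → invℕ (suc m) * invℕ (suc m) * g m)) (S-reverse q (λ n → invℕ (suc n ℕ.* suc n) * f n)))
    (D-S-minus q (λ m m<q → D-*-minus (zi (ℕ.∸-monoʳ-< (s≤s z≤n) m<q)) (zg m m<q)
      (inv²-reverse _ m (ℕ.m∸n+n≡m m<q)) (d _ m (ℕ.m∸n+n≡m m<q))))
    where
    zi : ∀ {n} → n ℕ.< q → Zp (invℕ (suc n ℕ.* suc n))
    zi {n} n<q = subst Zp (sym (inv-homo-* n n)) (Zp-* (Zp-inv n<q) (Zp-inv n<q))

  -- The first congruence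

  lhs₁ rhs₁ lhs₂ rhs₂ lhs₃ rhs₃ : Poly
  lhs₁ = sumP 0 q (λ k → ℕ→ℚ ((2 ℕ.* k) C k) ·ₚ tPow (q ℕ.∸ k))
  rhs₁ = (ℕ→ℚ 2 ·ₚ u[t,t] p) -ₚ u[2-t] p
        -ₚ (ℕ→ℚ (2 ℕ.* p ℕ.^ 2) ·ₚ sumP 1 q (λ k → invℕ (k ℕ.* k) ·ₚ (u[2-t] k +ₚ u[t,t] k)))
  lhs₂ = sumP 1 q (λ k → (ℕ→ℚ ((2 ℕ.* k) C k) * invℕ k) ·ₚ tPow (p ℕ.∸ k))
  rhs₂ = invℕ p ·ₚ ((ℕ→ℚ 3 ·ₚ tPow p) +ₚ constP (ℕ→ℚ 2) -ₚ v[2-t] p -ₚ (ℕ→ℚ 4 ·ₚ v[t,t] p))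
  lhs₃ = invℕ 2 ·ₚ sumP 1 q (λ k → (ℕ→ℚ ((2 ℕ.* k) C k) * invℕ (k ℕ.* k)) ·ₚ tPow (p ℕ.∸ k))
  rhs₃ = (invℕ (p ℕ.* p) ·ₚ (v[2-t] p +ₚ (ℕ→ℚ 2 ·ₚ v[t,t] p) -ₚ tPow p -ₚ constP (ℕ→ℚ 2)))
        +ₚ sumP 1 q (λ k → invℕ (k ℕ.* k) ·ₚ v[2-t] k)

  π≡ : ∀ {i k} → i ℕ.+ k ≡ q → π ≡ cast i + cast k + 1ℚ
  π≡ {i} {k} e = cong (_+ 1ℚ) (trans (cong cast (sym e)) (cast-+ i k))

  -- On the left only the summand with index k = p - 1 - i contributes to t^i. The sum on the right
  -- is multiplied by 2p², so replacing it by the sum of `bracket` is needed only mod p.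
  congruence₁-mid : ∀ {i k} → i ℕ.+ k ≡ q → D 3 (lhs₁ i - rhs₁ i)
  congruence₁-mid {i} {k} e = D-≡ (trans (cong₂ _-_ lhs≡ rhs≡) (lem (B a k) (B (a - π) k) (B (a - two * π) k) (π * π) Σ₁ (S q (bracket a k))))
      (D-+ (second-difference-error-cast (2 ℕ.* k) k k≤q) (D-* Zp-two (D-≡ (*-assoc π π _) (D-π (D-π Σ-cong)))))
    where
    open ≡-Reasoning
    a Σ₁ : ℚ
    a = cast (2 ℕ.* k)
    Σ₁ = S q (λ n → invℕ (suc n ℕ.* suc n) * (u[2-t] (suc n) i + u[t,t] (suc n) i))
    k≤q : k ℕ.≤ q
    k≤q = subst (k ℕ.≤_) e (ℕ.m≤n+m k i)
    a≡ : a ≡ two * cast k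
    a≡ = cast-double k
    lem : ∀ b b₁ b₂ w s t → b - (two * b₁ - b₂ - two * w * s) ≡ b - two * b₁ + b₂ + two * (w * t) + two * (w * (s - t))
    lem = solve-∀ ring
    arg₁ : - (two * cast (suc i)) ≡ a - two * π
    arg₁ = trans (lem₁ (cast i) (cast k)) (sym (cong₂ (λ x y → x - two * y) a≡ (π≡ {i} {k} e)))
      where
      lem₁ : ∀ i k → - (two * (i + 1ℚ)) ≡ two * k - two * (i + k + 1ℚ)
      lem₁ = solve-∀ ring
    arg₂ : ∀ n m → n ℕ.+ m ≡ q → cast n - 1ℚ - two * cast i ≡ a - π - cast m
    arg₂ n m e′ = by-cofactors (- 1ℚ ⊡ a≡ ⊞ two ⊡ π≡ {i} {k} e ⊞ - 1ℚ ⊡ π≡ {n} {m} e′) (lem₂ (cast i) (cast k) (cast n) (cast m) π a)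
      where
      lem₂ : ∀ i k n m p a → n - 1ℚ - two * i - (a - p - m)
        ≡ - 1ℚ * (a - two * k) + two * (p - (i + k + 1ℚ)) + - 1ℚ * (p - (n + m + 1ℚ))
      lem₂ = solve-∀ ring
    index : ∀ {n m} → n ℕ.+ m ≡ q → n ℕ.+ m ≡ k ℕ.+ i
    index e′ = trans e′ (trans (sym e) (ℕ.+-comm i k))
    u-value : ∀ n m → n ℕ.+ m ≡ q → u[2-t] (suc n) i ≡ sgn m * Bs (a - two * π) k m
    u-value n m e′ = trans (u[2-t]-coeff n i) (cong₂ _*_ (sgn-reverse n m e′)
      (trans (cong (λ c → Bs c n i) arg₁) (Bs-shift (a - two * π) {n} {i} {k} {m} (index {n} {m} e′))))
    w-value : ∀ n m → n ℕ.+ m ≡ q → u[t,t] (suc n) i ≡ Bs (a - π - cast m) k m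
    w-value n m e′ = trans (u[t,t]-coeff n i) (trans (cong (λ c → Bs c n i) (arg₂ n m e′)) (Bs-shift (a - π - cast m) {n} {i} {k} {m} (index {n} {m} e′)))
    lhs≡ : lhs₁ i ≡ B a k
    lhs≡ = trans (sumP₀≡S q _ i) (trans (S-tPow (λ k → ℕ→ℚ ((2 ℕ.* k) C k)) ℕ.≤-refl e (s≤s k≤q))
      (trans (ℕ→ℚ≡cast ((2 ℕ.* k) C k)) (C≡B (2 ℕ.* k) k)))
    rhs≡ : rhs₁ i ≡ two * B (a - π) k - B (a - two * π) k - two * (π * π) * Σ₁
    rhs≡ = cong₂ _-_ (cong₂ (λ x y → two * x - y)
        (trans (w-value q 0 (ℕ.+-identityʳ q)) (cong (λ c → B c k) (+-identityʳ (a - π))))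
        (trans (u-value q 0 (ℕ.+-identityʳ q)) (*-identityˡ _)))
      (cong₂ _*_ (trans (ℕ→ℚ≡cast (2 ℕ.* p ℕ.^ 2)) (trans (cast-double (p ℕ.^ 2))
          (cong (two *_) (trans (cast-* p (p ℕ.* 1)) (cong (λ n → π * cast n) (ℕ.*-identityʳ p))))))
        (sumP₁≡S q _ i))
    za : Zp a
    za = Zp-cast (2 ℕ.* k)
    Σ-cong : D 1 (Σ₁ - S q (bracket a k))
    Σ-cong = D-S-reverse
      (λ n m e′ → D-≡ (trans (cong₂ (λ x y → x + y - (sgn (suc m) * Bs a k (suc m) + Bs (a - cast (suc m)) k (suc m)))
            (u-value n (suc m) e′) (w-value n (suc m) e′)) (lem₃ (sgn (suc m)) (Bs (a - two * π) k (suc m)) _ (Bs a k (suc m)) _))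
        (D-+ (D-* (Zp-sgn (suc m)) (Bs-cong (Zp-minus za (Zp-* Zp-two Zp-π)) za (D-≡ (lem₄ a π) (D-neg (D-* Zp-two D1-π))) k≤q (suc m)))
             (Bs-cong (Zp-minus (Zp-minus za Zp-π) (Zp-cast (suc m))) (Zp-minus za (Zp-cast (suc m))) (D-≡ (lem₅ a π (cast (suc m))) (D-neg D1-π)) k≤q (suc m))))
      (λ m _ → Zp-+ (Zp-* (Zp-sgn (suc m)) (Zp-Bs za k≤q (suc m))) (Zp-Bs (Zp-minus za (Zp-cast (suc m))) k≤q (suc m)))
      where
      lem₃ : ∀ s x y z w → s * x + y - (s * z + w) ≡ s * (x - z) + (y - w)
      lem₃ = solve-∀ ring
      lem₄ : ∀ a p → a - two * p - a ≡ - (two * p)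
      lem₄ = solve-∀ ring
      lem₅ : ∀ a p c → a - p - c - (a - c) ≡ - p
      lem₅ = solve-∀ ring

  congruence₁ : CongP p 3 lhs₁ rhs₁
  congruence₁ i = D⇒InPmZp 3 (go (i ℕ.≤? q))
    where
    go : Dec (i ℕ.≤ q) → D 3 (lhs₁ i - rhs₁ i)
    go (yes i≤q) with k , e ← ℕ.m≤n⇒∃[o]m+o≡n i≤q = congruence₁-mid e
    go (no i≰q) = D-≡ (trans (cong₂ _-_ lhs≡ rhs≡) (lem (ℕ→ℚ (2 ℕ.* p ℕ.^ 2)))) D-0
      where
      q<i : q ℕ.< i
      q<i = ℕ.≰⇒> i≰q
      lem : ∀ w → 0ℚ - (two * 0ℚ - 0ℚ - w * 0ℚ) ≡ 0ℚ
      lem = solve-∀ ring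
      lhs≡ : lhs₁ i ≡ 0ℚ
      lhs≡ = trans (sumP₀≡S q _ i) (S-tPow-none q p (λ k → ℕ→ℚ ((2 ℕ.* k) C k)) (λ m _ → ℕ.<⇒≢ (ℕ.≤-<-trans (ℕ.m∸n≤m q m) q<i)))
      rhs≡ : rhs₁ i ≡ two * 0ℚ - 0ℚ - ℕ→ℚ (2 ℕ.* p ℕ.^ 2) * 0ℚ
      rhs≡ = cong₂ (λ x y → x - ℕ→ℚ (2 ℕ.* p ℕ.^ 2) * y)
        (cong₂ (λ x y → two * x - y) (u[t,t]-high q<i) (u[2-t]-high q<i))
        (trans (sumP₁≡S q _ i) (S-0 q (λ n n<q → trans (cong₂ (λ x y → invℕ (suc n ℕ.* suc n) * (x + y))
          (u[2-t]-high (ℕ.<⇒≤ (ℕ.≤-<-trans n<q q<i))) (u[t,t]-high (ℕ.<⇒≤ (ℕ.≤-<-trans n<q q<i)))) (*-zeroʳ (invℕ (suc n ℕ.* suc n))))))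

  -- The second and third congruences

  lhs-zero : ∀ (c : ℕ → ℚ) → sumP 1 q (λ k → c k ·ₚ tPow (p ℕ.∸ k)) 0 ≡ 0ℚ
  lhs-zero c = trans (sumP₁≡S q _ 0) (S-tPow-none q q (c ∘ suc) (λ m m<q e → ℕ.<⇒≱ m<q (ℕ.m∸n≡0⇒m≤n e)))

  lhs-high : ∀ (c : ℕ → ℚ) {i} → q ℕ.< i → sumP 1 q (λ k → c k ·ₚ tPow (p ℕ.∸ k)) i ≡ 0ℚ
  lhs-high c {i} q<i = trans (sumP₁≡S q _ i) (S-tPow-none q q (c ∘ suc) (λ m _ → ℕ.<⇒≢ (ℕ.≤-<-trans (ℕ.m∸n≤m q m) q<i)))

  lhs-mid : ∀ (c : ℕ → ℚ) {i k} → suc i ℕ.+ k ≡ q → sumP 1 q (λ k → c k ·ₚ tPow (p ℕ.∸ k)) (suc i) ≡ c (suc k)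
  lhs-mid c {i} {k} e = trans (sumP₁≡S q _ (suc i))
    (S-tPow (c ∘ suc) (ℕ.n≤1+n q) e (subst (suc k ℕ.≤_) e (s≤s (ℕ.m≤n+m k i))))

  -- Degrees 0 and p stand apart: the left sides have no such terms, while t^p, the constant 2 and
  -- the ends of v_p do.
  by-position : (P : ℕ → Set) → P 0 → (∀ {i k} → suc i ℕ.+ k ≡ q → P (suc i)) → P p → (∀ {i} → p ℕ.< i → P i) → ∀ i → P i
  by-position P h₀ h₁ h₂ h₃ i with ℕ.<-cmp i p
  ... | tri> _ _ p<i = h₃ p<i
  ... | tri≈ _ refl _ = h₂
  by-position P h₀ h₁ h₂ h₃ zero    | tri< _ _ _ = h₀
  by-position P h₀ h₁ h₂ h₃ (suc i) | tri< i<p _ _ with k , e ← ℕ.m≤n⇒∃[o]m+o≡n (ℕ.s≤s⁻¹ i<p) = h₁ e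

  v[2-t]-top : v[2-t] p p ≡ - 1ℚ
  v[2-t]-top = trans (v[2-t]-coeff q p) (cong₂ (λ s x → - (s * x)) sgn-q (cong₂ _-_ (Bs-diag _ p) (Bs-> _ (ℕ.n<1+n q))))

  v[t,t]-top : v[t,t] p p ≡ 1ℚ
  v[t,t]-top = trans (v[t,t]-coeff q q) (cong₂ _-_ (Bs-diag _ q) (Bs-> _ (ℕ.n<1+n q)))

  -- The coefficient of t^(i+1). The summand of the left sides that contributes has index k + 1,
  -- whence the upper argument a = 2(k+1) - 1.
  module mid {i k : ℕ} (e : suc i ℕ.+ k ≡ q) where

    a ik : ℚ
    a  = cast (suc (2 ℕ.* k))
    ik = invℕ (suc k)

    k<q : k ℕ.< q
    k<q = subst (suc k ℕ.≤_) e (s≤s (ℕ.m≤n+m k i))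

    i≢p : p ≢ suc i
    i≢p refl = ℕ.<⇒≱ (ℕ.n<1+n q) (subst (suc i ℕ.≤_) e (ℕ.m≤m+n (suc i) k))

    za : Zp a
    za = Zp-cast (suc (2 ℕ.* k))

    a≡ : a ≡ two * cast k + 1ℚ
    a≡ = cong (_+ 1ℚ) (cast-double k)

    arg₁ : - (two * cast (suc i)) - 1ℚ ≡ a - two * π
    arg₁ = by-cofactors (- 1ℚ ⊡ a≡ ⊞ two ⊡ π≡ {suc i} {k} e) (lem (cast i) (cast k) a π)
      where
      lem : ∀ i k a p → - (two * (i + 1ℚ)) - 1ℚ - (a - two * p) ≡ - 1ℚ * (a - (two * k + 1ℚ)) + two * (p - (i + 1ℚ + k + 1ℚ))
      lem = solve-∀ ring

    arg₂ : cast q - two * cast (suc i) ≡ a - π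
    arg₂ = by-cofactors (- 1ℚ ⊡ a≡ ⊞ two ⊡ π≡ {suc i} {k} e) (lem (cast i) (cast k) a (cast q))
      where
      lem : ∀ i k a q → q - two * (i + 1ℚ) - (a - (q + 1ℚ)) ≡ - 1ℚ * (a - (two * k + 1ℚ)) + two * (q + 1ℚ - (i + 1ℚ + k + 1ℚ))
      lem = solve-∀ ring

    index : ∀ n m → n ℕ.+ m ≡ q → n ℕ.+ m ≡ k ℕ.+ suc i
    index n m e′ = trans e′ (trans (sym e) (ℕ.+-comm (suc i) k))

    v-value : ∀ n m → n ℕ.+ m ≡ q → v[2-t] (suc n) (suc i) ≡ - (sgn m * (Bs (a - two * π) (suc k) m - Bs (a - two * π) k m))
    v-value n m e′ = trans (v[2-t]-coeff n (suc i)) (cong₂ (λ s x → - (s * x)) (sgn-reverse n m e′)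
      (trans (cong (λ c → Bs c (suc n) (suc i) - Bs c n (suc i)) arg₁)
        (cong₂ _-_ (Bs-shift (a - two * π) {suc n} {suc i} {suc k} {m} (cong suc (index n m e′)))
                   (Bs-shift (a - two * π) {n} {suc i} {k} {m} (index n m e′)))))

    -- The source of the explicit factor p: B(b, k+1) - B(b, k) = (b - 2k - 1)/(k+1) · B(b, k), and
    -- for b = a - 2p the numerator is -2p. For v_p(t,t) below, b = a - p makes it -p.
    v[2-t]≡ : v[2-t] p (suc i) ≡ two * π * ik * B (a - two * π) k
    v[2-t]≡ = trans (v-value q 0 (ℕ.+-identityʳ q))
      (by-cofactors (- (ik * b) ⊡ a≡ ⊞ - b ⊡ inv-* k) (lem (cast k) a π ik b))
      where
      b : ℚ
      b = B (a - two * π) k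
      lem : ∀ k a p i b → - (1ℚ * (b * (a - two * p - k) * i - b)) - two * p * i * b
          ≡ - (i * b) * (a - (two * k + 1ℚ)) + - b * (i * (k + 1ℚ) - 1ℚ)
      lem = solve-∀ ring

    v[t,t]≡ : v[t,t] p (suc i) ≡ - (π * ik * B (a - π) k)
    v[t,t]≡ = trans (v[t,t]-coeff q i) (trans
      (cong₂ _-_ (trans (cong (λ c → Bs c q i) arg₂) (Bs-shift (a - π) {q} {i} {suc k} {0} (trans (ℕ.+-identityʳ q) (trans (sym e) (trans (ℕ.+-comm (suc i) k) (ℕ.+-suc k i))))))
                 (trans (cong (λ c → Bs c q (suc i)) arg₂) (Bs-shift (a - π) {q} {suc i} {k} {0} (index q 0 (ℕ.+-identityʳ q)))))
      (by-cofactors (ik * b ⊡ a≡ ⊞ b ⊡ inv-* k) (lem (cast k) a π ik b)))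
      where
      b : ℚ
      b = B (a - π) k
      lem : ∀ k a p i b → b * (a - p - k) * i - b - - (p * i * b) ≡ i * b * (a - (two * k + 1ℚ)) + b * (i * (k + 1ℚ) - 1ℚ)
      lem = solve-∀ ring

    -- The factor p cancels the division by p, and the difference of the two sides is exactly
    -- 2/(k+1) times the second difference. Modulo p² its correction by `bracket` drops out.
    congruence₂-mid : D 2 (lhs₂ (suc i) - rhs₂ (suc i))
    congruence₂-mid = D-≡ (trans (cong₂ _-_ lhs≡ rhs≡)
        (by-cofactor (two * ik * (B (a - two * π) k - two * B (a - π) k)) (inv-* q)
          (lem (B a k) (B (a - π) k) (B (a - two * π) k) ik (invℕ p) π (S q (bracket a k)))))
      (D-* (Zp-* Zp-two (Zp-inv k<q)) (D-minus (D-weaken (second-difference-error-cast (suc (2 ℕ.* k)) k (ℕ.<⇒≤ k<q)))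
        (D-* Zp-two (D-≡ (*-assoc π π _) (D-ππ (Zp-bracket))))))
      where
      lem : ∀ b b₁ b₂ i j p s → two * b * i - j * (three * 0ℚ + 0ℚ - two * p * i * b₂ - four * - (p * i * b₁))
            - two * i * (b - two * b₁ + b₂ + two * (p * p * s) - two * (p * p * s))
          ≡ two * i * (b₂ - two * b₁) * (j * p - 1ℚ)
      lem = solve-∀ ring
      Zp-bracket : Zp (S q (bracket a k))
      Zp-bracket = Zp-S q (λ m m<q → Zp-* (Zp-* (Zp-inv m<q) (Zp-inv m<q))
        (Zp-+ (Zp-* (Zp-sgn (suc m)) (Zp-Bs za (ℕ.<⇒≤ k<q) (suc m))) (Zp-Bs (Zp-minus za (Zp-cast (suc m))) (ℕ.<⇒≤ k<q) (suc m))))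
      lhs≡ : lhs₂ (suc i) ≡ two * B a k * ik
      lhs≡ = trans (lhs-mid (λ k → ℕ→ℚ ((2 ℕ.* k) C k) * invℕ k) e) (cong (_* ik) (central k))
      rhs≡ : rhs₂ (suc i) ≡ invℕ p * (three * 0ℚ + 0ℚ - two * π * ik * B (a - two * π) k - four * - (π * ik * B (a - π) k))
      rhs≡ = cong (invℕ p *_) (cong₂ _-_ (cong₂ (λ x y → three * x + 0ℚ - y) (tPow-≢ i≢p) v[2-t]≡) (cong (four *_) v[t,t]≡))

    -- After the factor p is used, 1/p remains in front of the first difference, which costs one
    -- power. In `exact`, the part with `B a k` matches the left side and the part with `S₁` cancels
    -- the logarithmic value of the first difference.
    congruence₃-mid : D 1 (lhs₃ (suc i) - rhs₃ (suc i))
    congruence₃-mid = D-≡ (trans (cong₂ _-_ lhs≡ rhs≡)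
        (by-cofactors (ik * B a k * ik ⊡ inv-* 1 ⊞ - (two * ik * (B (a - two * π) k - B (a - π) k) * invℕ p + two * ik * S₁) ⊡ inv-* q ⊞ - 1ℚ ⊡ exact)
          (lem (B a k) (B (a - π) k) (B (a - two * π) k) ik (invℕ p) (invℕ 2) π S₁ Σ₁ Σ₂)))
      (D-neg (D-+ (D-* (Zp-* Zp-two (Zp-inv k<q)) (D-inv (first-difference-error-cast (suc (2 ℕ.* k)) k (ℕ.<⇒≤ k<q)))) Σ-cong))
      where
      open ≡-Reasoning
      S₁ Σ₁ Σ₂ : ℚ
      S₁ = S q (log-term a k)
      Σ₁ = S q (λ n → invℕ (suc n ℕ.* suc n) * v[2-t] (suc n) (suc i))
      g : ℕ → ℚ
      g m = - (sgn (suc m) * (Bs a (suc k) (suc m) - Bs a k (suc m)))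
      Σ₂ = S q (λ m → invℕ (suc m) * invℕ (suc m) * g m)
      lem : ∀ b b₁ b₂ i j h p s x y → h * (two * b * (i * i))
              - (j * j * (two * p * i * b₂ + two * - (p * i * b₁) - 0ℚ - 0ℚ) + x)
              - - (two * i * (j * (b₂ - b₁ - p * s)) + (x - y))
          ≡ i * b * i * (h * (1ℚ + 1ℚ) - 1ℚ)
            + - (two * i * (b₂ - b₁) * j + two * i * s) * (j * p - 1ℚ)
            + - 1ℚ * (y - (i * i * b - two * i * s))
      lem = solve-∀ ring
      lhs≡ : lhs₃ (suc i) ≡ invℕ 2 * (two * B a k * (ik * ik))
      lhs≡ = cong (invℕ 2 *_) (trans (lhs-mid (λ k → ℕ→ℚ ((2 ℕ.* k) C k) * invℕ (k ℕ.* k)) e)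
        (cong₂ _*_ (central k) (inv-homo-* k k)))
      rhs≡ : rhs₃ (suc i) ≡ invℕ p * invℕ p * (two * π * ik * B (a - two * π) k + two * - (π * ik * B (a - π) k) - 0ℚ - 0ℚ) + Σ₁
      rhs≡ = cong₂ _+_ (cong₂ _*_ (inv-homo-* q q)
          (cong (_- 0ℚ) (cong₂ _-_ (cong₂ (λ x y → x + two * y) v[2-t]≡ v[t,t]≡) (tPow-≢ i≢p))))
        (sumP₁≡S q _ (suc i))
      exact : Σ₂ ≡ ik * ik * B a k - two * ik * S₁
      exact = begin
        Σ₂ ≡⟨ S-cong q (λ m _ → term m) ⟩
        S q (λ m → - (ik * ik) * (sgn (suc m) * Bs (a + 1ℚ) (suc k) (suc m)) + - (two * ik) * log-term a k m)
          ≡⟨ S-+ q (λ m → - (ik * ik) * (sgn (suc m) * Bs (a + 1ℚ) (suc k) (suc m))) _ ⟩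
        S q (λ m → - (ik * ik) * (sgn (suc m) * Bs (a + 1ℚ) (suc k) (suc m))) + S q (λ m → - (two * ik) * log-term a k m)
          ≡⟨ cong₂ _+_ (S-* q (- (ik * ik)) _) (S-* q (- (two * ik)) (log-term a k)) ⟩
        - (ik * ik) * S q (λ m → sgn (suc m) * Bs (a + 1ℚ) (suc k) (suc m)) + - (two * ik) * S₁
          ≡⟨ cong (λ x → - (ik * ik) * x + - (two * ik) * S₁) (alternating-central a k<q) ⟩
        - (ik * ik) * - B a k + - (two * ik) * S₁ ≡⟨ lem₁ ik (B a k) S₁ ⟩
        ik * ik * B a k - two * ik * S₁ ∎
        where
        lem₁ : ∀ i b s → - (i * i) * - b + - (two * i) * s ≡ i * i * b - two * i * s
        lem₁ = solve-∀ ring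
        lem₂ : ∀ j i s x z y → j * j * - (s * (x - z)) - (- (i * i) * (s * y) + - (two * i) * (s * j * z))
             ≡ - (j * s + i * s) * (j * (x - z) - i * y) + - (i * j * s) * (y - (x + z))
        lem₂ = solve-∀ ring
        term : ∀ m → invℕ (suc m) * invℕ (suc m) * g m
             ≡ - (ik * ik) * (sgn (suc m) * Bs (a + 1ℚ) (suc k) (suc m)) + - (two * ik) * log-term a k m
        -- Write Δ for the difference in `g` without its sign, y for the binomial in row a + 1, z
        -- for `Bs a k (suc m)`, and M = m + 1, K = k + 1. Then Δ/M = y/K and y = Δ + 2z, so Δ/M² =
        -- y/(MK) = (Δ/M + 2z/M)/K = y/K² + 2z/(MK): `central-difference` is used twice.
        term m = by-cofactors
          (- (invℕ (suc m) * sgn (suc m) + ik * sgn (suc m)) ⊡ central-difference k m ⊞ - (ik * invℕ (suc m) * sgn (suc m)) ⊡ Bs-pascal a k (suc m))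
          (lem₂ (invℕ (suc m)) ik (sgn (suc m)) (Bs a (suc k) (suc m)) (Bs a k (suc m)) (Bs (a + 1ℚ) (suc k) (suc m)))
      Σ-cong : D 1 (Σ₁ - Σ₂)
      Σ-cong = D-S-reverse
        (λ n m e′ → D-≡ (trans (cong (_- g m) (v-value n (suc m) e′))
            (lem₃ (sgn (suc m)) (Bs (a - two * π) (suc k) (suc m)) (Bs (a - two * π) k (suc m)) (Bs a (suc k) (suc m)) (Bs a k (suc m))))
          (D-* (Zp-sgn (suc m)) (D-minus (diff (ℕ.<⇒≤ k<q) (suc m)) (diff k<q (suc m)))))
        (λ m _ → Zp-neg (Zp-* (Zp-sgn (suc m)) (Zp-minus (Zp-Bs za k<q (suc m)) (Zp-Bs za (ℕ.<⇒≤ k<q) (suc m)))))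
        where
        lem₃ : ∀ s x y z w → - (s * (x - y)) - - (s * (z - w)) ≡ s * ((y - w) - (x - z))
        lem₃ = solve-∀ ring
        lem₄ : ∀ a p → a - two * p - a ≡ - (two * p)
        lem₄ = solve-∀ ring
        diff : ∀ {k} → k ℕ.≤ q → ∀ m → D 1 (Bs (a - two * π) k m - Bs a k m)
        diff = Bs-cong (Zp-minus za (Zp-* Zp-two Zp-π)) za (D-≡ (lem₄ a π) (D-neg (D-* Zp-two D1-π)))

  congruence₂ : CongP p 2 lhs₂ rhs₂
  congruence₂ = D⇒InPmZp 2 ∘ by-position (λ i → D 2 (lhs₂ i - rhs₂ i))
    (exact 0 (lhs-zero c₂) (trans (values 0 (tPow-≢ {p} {0} (λ ())) (v[2-t]-coeff-0 q) (v[t,t]-coeff-0 q)) (lem₀ (invℕ p))))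
    mid.congruence₂-mid
    -- In degree p the values 1, -1, 1 of t^p, v_p(2-t), v_p(t,t) give 3 + 1 - 4 = 0.
    (exact p (lhs-high c₂ (ℕ.n<1+n q)) (trans (values p (tPow-≡ p) v[2-t]-top v[t,t]-top) (lem₁ (invℕ p))))
    (λ {i} p<i → exact i (lhs-high c₂ (ℕ.<⇒≤ p<i)) (trans (values i (tPow-≢ (ℕ.<⇒≢ p<i)) (v[2-t]-high p<i) (v[t,t]-high p<i)) (high i p<i)))
    where
    c₂ : ℕ → ℚ
    c₂ k = ℕ→ℚ ((2 ℕ.* k) C k) * invℕ k
    exact : ∀ i → lhs₂ i ≡ 0ℚ → rhs₂ i ≡ 0ℚ → D 2 (lhs₂ i - rhs₂ i)
    exact i l r = D-≡ (cong₂ _-_ l r) D-0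
    values : ∀ i {x y z} → tPow p i ≡ x → v[2-t] p i ≡ y → v[t,t] p i ≡ z
      → rhs₂ i ≡ invℕ p * (three * x + constP two i - y - four * z)
    values i refl refl refl = refl
    lem₀ : ∀ j → j * (three * 0ℚ + two - two - four * 0ℚ) ≡ 0ℚ
    lem₀ = solve-∀ ring
    lem₁ : ∀ j → j * (three * 1ℚ + 0ℚ - - 1ℚ - four * 1ℚ) ≡ 0ℚ
    lem₁ = solve-∀ ring
    lem₂ : ∀ j → j * (three * 0ℚ + 0ℚ - 0ℚ - four * 0ℚ) ≡ 0ℚ
    lem₂ = solve-∀ ring
    high : ∀ i → p ℕ.< i → invℕ p * (three * 0ℚ + constP two i - 0ℚ - four * 0ℚ) ≡ 0ℚ
    high (suc i) _ = lem₂ (invℕ p)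

  congruence₃ : CongP p 1 lhs₃ rhs₃
  congruence₃ = D⇒InPmZp 1 ∘ by-position (λ i → D 1 (lhs₃ i - rhs₃ i))
    (D-≡ (trans (cong₂ _-_ (cong (invℕ 2 *_) (lhs-zero c₃))
            (values 0 (tPow-≢ {p} {0} (λ ())) (v[2-t]-coeff-0 q) (v[t,t]-coeff-0 q) constant-sum))
          (lem₀ (invℕ 2) (invℕ (p ℕ.* p)) (S q (λ m → invℕ (suc m) * invℕ (suc m)))))
        (D-neg (D-* Zp-two wolstenholme)))
    mid.congruence₃-mid
    -- The same values give -1 + 2 - 1 = 0, and every v_n(2-t) with n < p has degree below p.
    (exact p (lhs-high c₃ (ℕ.n<1+n q))
      (trans (values p (tPow-≡ p) v[2-t]-top v[t,t]-top (sum-high ℕ.≤-refl)) (lem₁ (invℕ (p ℕ.* p)))))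
    (λ {i} p<i → exact i (lhs-high c₃ (ℕ.<⇒≤ p<i))
      (trans (values i (tPow-≢ (ℕ.<⇒≢ p<i)) (v[2-t]-high p<i) (v[t,t]-high p<i) (sum-high (ℕ.<⇒≤ p<i))) (high i p<i)))
    where
    c₃ : ℕ → ℚ
    c₃ k = ℕ→ℚ ((2 ℕ.* k) C k) * invℕ (k ℕ.* k)
    exact : ∀ i → sumP 1 q (λ k → c₃ k ·ₚ tPow (p ℕ.∸ k)) i ≡ 0ℚ → rhs₃ i ≡ 0ℚ → D 1 (lhs₃ i - rhs₃ i)
    exact i l r = D-≡ (trans (cong₂ (λ x y → invℕ 2 * x - y) l r) (lem (invℕ 2))) D-0
      where
      lem : ∀ h → h * 0ℚ - 0ℚ ≡ 0ℚ
      lem = solve-∀ ring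
    values : ∀ i {x y z s} → tPow p i ≡ x → v[2-t] p i ≡ y → v[t,t] p i ≡ z
      → S q (λ n → invℕ (suc n ℕ.* suc n) * v[2-t] (suc n) i) ≡ s
      → rhs₃ i ≡ invℕ (p ℕ.* p) * (y + two * z - x - constP two i) + s
    values i refl refl refl refl = cong (rhs₃-main +_) (sumP₁≡S q _ i)
      where
      rhs₃-main : ℚ
      rhs₃-main = invℕ (p ℕ.* p) * (v[2-t] p i + two * v[t,t] p i - tPow p i - constP two i)
    constant-sum : S q (λ n → invℕ (suc n ℕ.* suc n) * v[2-t] (suc n) 0) ≡ two * S q (λ m → invℕ (suc m) * invℕ (suc m))
    constant-sum = trans (S-cong q (λ n _ → trans (cong₂ _*_ (inv-homo-* n n) (v[2-t]-coeff-0 n)) (*-comm (invℕ (suc n) * invℕ (suc n)) two))) (S-* q two (λ m → invℕ (suc m) * invℕ (suc m)))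
    sum-high : ∀ {i} → p ℕ.≤ i → S q (λ n → invℕ (suc n ℕ.* suc n) * v[2-t] (suc n) i) ≡ 0ℚ
    sum-high p≤i = S-0 q (λ n n<q → trans (cong (invℕ (suc n ℕ.* suc n) *_) (v[2-t]-high (ℕ.<-≤-trans (s≤s n<q) p≤i)))
      (*-zeroʳ (invℕ (suc n ℕ.* suc n))))
    lem₀ : ∀ h j s → h * 0ℚ - (j * (two + two * 0ℚ - 0ℚ - two) + two * s) ≡ - (two * s)
    lem₀ = solve-∀ ring
    lem₁ : ∀ j → j * (- 1ℚ + two * 1ℚ - 1ℚ - 0ℚ) + 0ℚ ≡ 0ℚ
    lem₁ = solve-∀ ring
    lem₂ : ∀ j → j * (0ℚ + two * 0ℚ - 0ℚ - 0ℚ) + 0ℚ ≡ 0ℚ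
    lem₂ = solve-∀ ring
    high : ∀ i → p ℕ.< i → invℕ (p ℕ.* p) * (0ℚ + two * 0ℚ - 0ℚ - constP two i) + 0ℚ ≡ 0ℚ
    high (suc i) _ = lem₂ (invℕ (p ℕ.* p))

theorem7p1 : (p : ℕ) → Prime p → 3 ℕ.< p →
    CongP p 3
    (sumP 0 (p ℕ.∸ 1) (λ k → ℕ→ℚ ((2 ℕ.* k) C k) ·ₚ tPow (p ℕ.∸ 1 ℕ.∸ k)))
    ((ℕ→ℚ 2 ·ₚ uL T T p) -ₚ u₁ twoMinusT p
    -ₚ (ℕ→ℚ (2 ℕ.* p ℕ.^ 2) ·ₚ sumP 1 (p ℕ.∸ 1) (λ k → invℕ (k ℕ.* k) ·ₚ (u₁ twoMinusT k +ₚ uL T T k))))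
    × CongP p 2
    (sumP 1 (p ℕ.∸ 1) (λ k → (ℕ→ℚ ((2 ℕ.* k) C k) * invℕ k) ·ₚ tPow (p ℕ.∸ k)))
    (invℕ p ·ₚ ((ℕ→ℚ 3 ·ₚ tPow p) +ₚ constP (ℕ→ℚ 2) -ₚ v₁ twoMinusT p -ₚ (ℕ→ℚ 4 ·ₚ vL T T p)))
    × CongP p 1
    (invℕ 2 ·ₚ sumP 1 (p ℕ.∸ 1) (λ k → (ℕ→ℚ ((2 ℕ.* k) C k) * invℕ (k ℕ.* k)) ·ₚ tPow (p ℕ.∸ k)))
    ((invℕ (p ℕ.* p) ·ₚ (v₁ twoMinusT p +ₚ (ℕ→ℚ 2 ·ₚ vL T T p) -ₚ tPow p -ₚ constP (ℕ→ℚ 2)))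
    +ₚ sumP 1 (p ℕ.∸ 1) (λ k → invℕ (k ℕ.* k) ·ₚ v₁ twoMinusT k))
theorem7p1 (suc q) p-prime 3<p = congruence₁ , congruence₂ , congruence₃
  where open p-adic q p-prime 3<p
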